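{- There is an algorithm which, given any formula $F$ containing no occurrences of the blind quantifiers $\forall,\exists$, decides whether $\mathbf{CL2}\vdash F$.
   Context: Formulas are built from nonlogical atoms $p(t_1,\ldots,t_n)$ ($p$ an $n$-ary predicate letter, $t_i$ terms, where terms are variables $v_0,v_1,\ldots$ and constants $0,1,2,\ldots$) and logical atoms $\top,\bot$ by $\neg$, $\wedge,\vee$ ($n$-ary, $n\ge2$), $\rightarrow$, $\sqcap,\sqcup$ ($n$-ary, $n\ge2$) and quantifiers $\forall x,\exists x,\sqcap x,\sqcup x$ (all binding variables). Constants count as free. $G(y)$, $G(t)$ denote the result of substituting $y$, $t$ for the free occurrences of $x$ in $G(x)$. Logic $\mathbf{CL2}$. Reading $F\rightarrow G$ as $\neg F\vee G$, an occurrence of a subformula is positive (negative) if it is in the scope of an even (odd) number of $\neg$; it is a surface occurrence if not in the scope of any of $\sqcap,\sqcup,\sqcap x,\sqcup x$. The elementarization of $F$ replaces every surface occurrence of a subformula $G_1\sqcup\cdots\sqcup G_n$ or $\sqcup xG$ by $\bot$ and every surface occurrence of $G_1\sqcap\cdots\sqcap G_n$ or $\sqcap xG$ by $\top$; $F$ is stable iff its elementarization is valid in classical first-order logic (without equality or function symbols; $\top,\bot$ are truth and falsity). Rules (premises $\mapsto$ conclusion): Rule A: $\vec H\mapsto F$, where $F$ is stable and $\vec H$ is a set of formulas such that (i) whenever $F$ has a positive (resp. negative) surface occurrence of $G_1\sqcap\cdots\sqcap G_n$ (resp. $G_1\sqcup\cdots\sqcup G_n$), for each $i$, $\vec H$ contains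 the result of replacing that occurrence in $F$ by $G_i$; (ii) whenever $F$ has a positive (resp. negative) surface occurrence of $\sqcap xG(x)$ (resp. $\sqcup xG(x)$), $\vec H$ contains the result of replacing that occurrence by $G(y)$ for some variable $y$ not occurring in $F$. Rule B1: $F'\mapsto F$, where $F'$ results from $F$ by replacing a negative (resp. positive) surface occurrence of $G_1\sqcap\cdots\sqcap G_n$ (resp. $G_1\sqcup\cdots\sqcup G_n$) by some $G_i$. Rule B2: $F'\mapsto F$, where $F'$ results from $F$ by replacing a negative (resp. positive) surface occurrence of $\sqcap xG(x)$ (resp. $\sqcup xG(x)$) by $G(t)$ for a term $t$ such that, if $t$ is a variable, neither that occurrence nor any free occurrence of $x$ in $G(x)$ is in the scope of $\forall t,\exists t,\sqcap t,\sqcup t$. $\mathbf{CL2}\vdash F$ means $F$ is derivable by these rules (Rule A with empty $\vec H$ acts as an axiom rule). -}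

module Defs where

open import Data.Nat using (ℕ; _≡ᵇ_)
open import Data.Bool using (Bool; true; false; if_then_else_; _∨_; not)
open import Data.List using (List; []; _∷_; _++_; length)
open import Data.Vec using (Vec; []; _∷_)
open import Data.Unit using (⊤)
open import Data.Empty using (⊥)
open import Data.Product using (Σ; _×_; _,_)
open import Relation.Nullary using (¬_)
open import Relation.Binary.PropositionalEquality using (_≡_)
open import Data.List.Membership.Propositional using (_∈_)

data Term : Set where
  var : ℕ → Term
  con : ℕ → Term

-- An n-ary connective (n ≥ 2) is given by its first two
-- arguments and a list of further ones.  A predicate letter is a name
-- (a natural number) together with its arity (= number of arguments).
data Formula : Set where
  atom : ℕ → List Term → Formula
  top  : Formula
  bot  : Formula
  neg  : Formula → Formula
  and  : Formula → Formula → List Formula → Formula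
  or   : Formula → Formula → List Formula → Formula
  imp  : Formula → Formula → Formula
  cand : Formula → Formula → List Formula → Formula
  cor  : Formula → Formula → List Formula → Formula
  all  : ℕ → Formula → Formula
  ex   : ℕ → Formula → Formula
  call : ℕ → Formula → Formula
  cex  : ℕ → Formula → Formula

-- naive substitution of the term t for the free occurrences of x
substT : ℕ → Term → Term → Term
substT x t (var z) = if z ≡ᵇ x then t else var z
substT x t (con c) = con c

substTs : ℕ → Term → List Term → List Term
substTs x t []       = []
substTs x t (s ∷ ss) = substT x t s ∷ substTs x t ss

mutual
  subst : ℕ → Term → Formula → Formula
  subst x t (atom p ts)  = atom p (substTs x t ts)
  subst x t top          = top
  subst x t bot          = bot
  subst x t (neg F)      = neg (subst x t F)
  subst x t (and F G Hs) = and (subst x t F) (subst x t G) (substs x t Hs)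
  subst x t (or F G Hs)  = or (subst x t F) (subst x t G) (substs x t Hs)
  subst x t (imp F G)    = imp (subst x t F) (subst x t G)
  subst x t (cand F G Hs) = cand (subst x t F) (subst x t G) (substs x t Hs)
  subst x t (cor F G Hs)  = cor (subst x t F) (subst x t G) (substs x t Hs)
  subst x t (all z F)  = if z ≡ᵇ x then all z F  else all z (subst x t F)
  subst x t (ex z F)   = if z ≡ᵇ x then ex z F   else ex z (subst x t F)
  subst x t (call z F) = if z ≡ᵇ x then call z F else call z (subst x t F)
  subst x t (cex z F)  = if z ≡ᵇ x then cex z F  else cex z (subst x t F)

  substs : ℕ → Term → List Formula → List Formula
  substs x t []       = []
  substs x t (F ∷ Fs) = subst x t F ∷ substs x t Fs

occT : ℕ → Term → Bool
occT y (var z) = z ≡ᵇ y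
occT y (con c) = false

occTs : ℕ → List Term → Bool
occTs y []       = false
occTs y (t ∷ ts) = occT y t ∨ occTs y ts

mutual
  occurs : ℕ → Formula → Bool
  occurs y (atom p ts)   = occTs y ts
  occurs y top           = false
  occurs y bot           = false
  occurs y (neg F)       = occurs y F
  occurs y (and F G Hs)  = occurs y F ∨ occurs y G ∨ occursL y Hs
  occurs y (or F G Hs)   = occurs y F ∨ occurs y G ∨ occursL y Hs
  occurs y (imp F G)     = occurs y F ∨ occurs y G
  occurs y (cand F G Hs) = occurs y F ∨ occurs y G ∨ occursL y Hs
  occurs y (cor F G Hs)  = occurs y F ∨ occurs y G ∨ occursL y Hs
  occurs y (all z F)  = (z ≡ᵇ y) ∨ occurs y F
  occurs y (ex z F)   = (z ≡ᵇ y) ∨ occurs y F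
  occurs y (call z F) = (z ≡ᵇ y) ∨ occurs y F
  occurs y (cex z F)  = (z ≡ᵇ y) ∨ occurs y F

  occursL : ℕ → List Formula → Bool
  occursL y []       = false
  occursL y (F ∷ Fs) = occurs y F ∨ occursL y Fs

mutual
  freeIn : ℕ → Formula → Bool
  freeIn x (atom p ts)   = occTs x ts
  freeIn x top           = false
  freeIn x bot           = false
  freeIn x (neg F)       = freeIn x F
  freeIn x (and F G Hs)  = freeIn x F ∨ freeIn x G ∨ freeInL x Hs
  freeIn x (or F G Hs)   = freeIn x F ∨ freeIn x G ∨ freeInL x Hs
  freeIn x (imp F G)     = freeIn x F ∨ freeIn x G
  freeIn x (cand F G Hs) = freeIn x F ∨ freeIn x G ∨ freeInL x Hs
  freeIn x (cor F G Hs)  = freeIn x F ∨ freeIn x G ∨ freeInL x Hs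
  freeIn x (all z F)  = if z ≡ᵇ x then false else freeIn x F
  freeIn x (ex z F)   = if z ≡ᵇ x then false else freeIn x F
  freeIn x (call z F) = if z ≡ᵇ x then false else freeIn x F
  freeIn x (cex z F)  = if z ≡ᵇ x then false else freeIn x F

  freeInL : ℕ → List Formula → Bool
  freeInL x []       = false
  freeInL x (F ∷ Fs) = freeIn x F ∨ freeInL x Fs

mutual
  freeUnder : ℕ → ℕ → Formula → Bool
  freeUnder t x (atom p ts)   = false
  freeUnder t x top           = false
  freeUnder t x bot           = false
  freeUnder t x (neg F)       = freeUnder t x F
  freeUnder t x (and F G Hs)  = freeUnder t x F ∨ freeUnder t x G ∨ freeUnderL t x Hs
  freeUnder t x (or F G Hs)   = freeUnder t x F ∨ freeUnder t x G ∨ freeUnderL t x Hs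
  freeUnder t x (imp F G)     = freeUnder t x F ∨ freeUnder t x G
  freeUnder t x (cand F G Hs) = freeUnder t x F ∨ freeUnder t x G ∨ freeUnderL t x Hs
  freeUnder t x (cor F G Hs)  = freeUnder t x F ∨ freeUnder t x G ∨ freeUnderL t x Hs
  freeUnder t x (all z F)  = binder t x z F
  freeUnder t x (ex z F)   = binder t x z F
  freeUnder t x (call z F) = binder t x z F
  freeUnder t x (cex z F)  = binder t x z F

  binder : ℕ → ℕ → ℕ → Formula → Bool
  binder t x z F =
    if z ≡ᵇ x then false
    else (if z ≡ᵇ t then freeIn x F else freeUnder t x F)

  freeUnderL : ℕ → ℕ → List Formula → Bool
  freeUnderL t x []       = false
  freeUnderL t x (F ∷ Fs) = freeUnder t x F ∨ freeUnderL t x Fs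

mutual
  blindFree : Formula → Bool
  blindFree (atom p ts)   = true
  blindFree top           = true
  blindFree bot           = true
  blindFree (neg F)       = blindFree F
  blindFree (and F G Hs)  = blindFree F Data.Bool.∧ blindFree G Data.Bool.∧ blindFreeL Hs
  blindFree (or F G Hs)   = blindFree F Data.Bool.∧ blindFree G Data.Bool.∧ blindFreeL Hs
  blindFree (imp F G)     = blindFree F Data.Bool.∧ blindFree G
  blindFree (cand F G Hs) = blindFree F Data.Bool.∧ blindFree G Data.Bool.∧ blindFreeL Hs
  blindFree (cor F G Hs)  = blindFree F Data.Bool.∧ blindFree G Data.Bool.∧ blindFreeL Hs
  blindFree (all z F)  = false
  blindFree (ex z F)   = false
  blindFree (call z F) = blindFree F
  blindFree (cex z F)  = blindFree F

  blindFreeL : List Formula → Bool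
  blindFreeL []       = true
  blindFreeL (F ∷ Fs) = blindFree F Data.Bool.∧ blindFreeL Fs

-- Surface contexts: a formula with one hole, where the hole is not in
-- the scope of any of ⊓, ⊔, ⊓x, ⊔x.  Plugging identifies a surface
-- occurrence of a subformula.

data Ctx : Set where
  hole  : Ctx
  negC  : Ctx → Ctx
  and₀  : Ctx → Formula → List Formula → Ctx
  and₁  : Formula → Ctx → List Formula → Ctx
  andR  : Formula → Formula → List Formula → Ctx → List Formula → Ctx
  or₀   : Ctx → Formula → List Formula → Ctx
  or₁   : Formula → Ctx → List Formula → Ctx
  orR   : Formula → Formula → List Formula → Ctx → List Formula → Ctx
  impL  : Ctx → Formula → Ctx
  impR  : Formula → Ctx → Ctx
  allC  : ℕ → Ctx → Ctx
  exC   : ℕ → Ctx → Ctx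

plug : Ctx → Formula → Formula
plug hole X               = X
plug (negC c) X           = neg (plug c X)
plug (and₀ c G Hs) X      = and (plug c X) G Hs
plug (and₁ F c Hs) X      = and F (plug c X) Hs
plug (andR F G ls c rs) X = and F G (ls ++ plug c X ∷ rs)
plug (or₀ c G Hs) X       = or (plug c X) G Hs
plug (or₁ F c Hs) X       = or F (plug c X) Hs
plug (orR F G ls c rs) X  = or F G (ls ++ plug c X ∷ rs)
plug (impL c G) X         = imp (plug c X) G
plug (impR F c) X         = imp F (plug c X)
plug (allC z c) X         = all z (plug c X)
plug (exC z c) X          = ex z (plug c X)

-- polarity of the hole (true = positive); F → G is read as ¬F ∨ G
positive : Ctx → Bool
positive hole               = true
positive (negC c)           = not (positive c)
positive (and₀ c _ _)       = positive c
positive (and₁ _ c _)       = positive c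
positive (andR _ _ _ c _)   = positive c
positive (or₀ c _ _)        = positive c
positive (or₁ _ c _)        = positive c
positive (orR _ _ _ c _)    = positive c
positive (impL c _)         = not (positive c)
positive (impR _ c)         = positive c
positive (allC _ c)         = positive c
positive (exC _ c)          = positive c

-- is the hole in the scope of ∀t or ∃t ?  (surface contexts contain no
-- choice quantifiers)
ctxBinds : ℕ → Ctx → Bool
ctxBinds t hole               = false
ctxBinds t (negC c)           = ctxBinds t c
ctxBinds t (and₀ c _ _)       = ctxBinds t c
ctxBinds t (and₁ _ c _)       = ctxBinds t c
ctxBinds t (andR _ _ _ c _)   = ctxBinds t c
ctxBinds t (or₀ c _ _)        = ctxBinds t c
ctxBinds t (or₁ _ c _)        = ctxBinds t c
ctxBinds t (orR _ _ _ c _)    = ctxBinds t c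
ctxBinds t (impL c _)         = ctxBinds t c
ctxBinds t (impR _ c)         = ctxBinds t c
ctxBinds t (allC z c)         = (z ≡ᵇ t) ∨ ctxBinds t c
ctxBinds t (exC z c)          = (z ≡ᵇ t) ∨ ctxBinds t c

data CFormula : Set where
  atom : ℕ → List Term → CFormula
  top  : CFormula
  bot  : CFormula
  neg  : CFormula → CFormula
  and  : CFormula → CFormula → List CFormula → CFormula
  or   : CFormula → CFormula → List CFormula → CFormula
  imp  : CFormula → CFormula → CFormula
  all  : ℕ → CFormula → CFormula
  ex   : ℕ → CFormula → CFormula

mutual
  elem : Formula → CFormula
  elem (atom p ts)   = atom p ts
  elem top           = top
  elem bot           = bot
  elem (neg F)       = neg (elem F)
  elem (and F G Hs)  = and (elem F) (elem G) (elemL Hs)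
  elem (or F G Hs)   = or (elem F) (elem G) (elemL Hs)
  elem (imp F G)     = imp (elem F) (elem G)
  elem (cand _ _ _)  = top
  elem (cor _ _ _)   = bot
  elem (all z F)     = all z (elem F)
  elem (ex z F)      = ex z (elem F)
  elem (call _ _)    = top
  elem (cex _ _)     = bot

  elemL : List Formula → List CFormula
  elemL []       = []
  elemL (F ∷ Fs) = elem F ∷ elemL Fs

-- A first-order structure: a nonempty domain, an interpretation of each
-- n-ary predicate letter (name p, arity n) and of each constant.
record Structure : Set₁ where
  field
    D     : Set
    d₀    : D
    pred  : ℕ → (n : ℕ) → Vec D n → Set
    const : ℕ → D

module _ (M : Structure) where
  open Structure M

  evalT : (ℕ → D) → Term → D
  evalT ρ (var x) = ρ x
  evalT ρ (con c) = const c

  evalTs : (ℕ → D) → (ts : List Term) → Vec D (length ts)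
  evalTs ρ []       = []
  evalTs ρ (t ∷ ts) = evalT ρ t ∷ evalTs ρ ts

  update : (ℕ → D) → ℕ → D → (ℕ → D)
  update ρ x d z = if z ≡ᵇ x then d else ρ z

  -- classical truth, via the Gödel–Gentzen negative translation
  mutual
    Tr : (ℕ → D) → CFormula → Set
    Tr ρ (atom p ts)  = ¬ ¬ pred p (length ts) (evalTs ρ ts)
    Tr ρ top          = ⊤
    Tr ρ bot          = ⊥
    Tr ρ (neg F)      = ¬ Tr ρ F
    Tr ρ (and F G Hs) = Tr ρ F × Tr ρ G × TrAll ρ Hs
    Tr ρ (or F G Hs)  = ¬ (¬ Tr ρ F × ¬ Tr ρ G × NoneTr ρ Hs)
    Tr ρ (imp F G)    = Tr ρ F → Tr ρ G
    Tr ρ (all x F)    = (d : D) → Tr (update ρ x d) F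
    Tr ρ (ex x F)     = ¬ ((d : D) → ¬ Tr (update ρ x d) F)

    TrAll : (ℕ → D) → List CFormula → Set
    TrAll ρ []       = ⊤
    TrAll ρ (F ∷ Fs) = Tr ρ F × TrAll ρ Fs

    NoneTr : (ℕ → D) → List CFormula → Set
    NoneTr ρ []       = ⊤
    NoneTr ρ (F ∷ Fs) = ¬ Tr ρ F × NoneTr ρ Fs

Valid : CFormula → Set₁
Valid F = (M : Structure) (ρ : ℕ → Structure.D M) → Tr M ρ F

Stable : Formula → Set₁
Stable F = Valid (elem F)

-- side condition of Rule B2 for replacing the occurrence at context c
-- of ⊓xG / ⊔xG by G(t)
B2ok : Ctx → ℕ → Formula → Term → Set
B2ok c x G (con _) = ⊤
B2ok c x G (var v) = (ctxBinds v c ∨ freeUnder v x G) ≡ false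

data CL2⊢_ : Formula → Set₁ where
  ruleA : ∀ {F} → Stable F
    → (∀ c G₁ G₂ Gs → plug c (cand G₁ G₂ Gs) ≡ F → positive c ≡ true
         → ∀ G → G ∈ (G₁ ∷ G₂ ∷ Gs) → CL2⊢ plug c G)
    → (∀ c G₁ G₂ Gs → plug c (cor G₁ G₂ Gs) ≡ F → positive c ≡ false
         → ∀ G → G ∈ (G₁ ∷ G₂ ∷ Gs) → CL2⊢ plug c G)
    → (∀ c x G → plug c (call x G) ≡ F → positive c ≡ true
         → Σ ℕ λ y → (occurs y F ≡ false) × CL2⊢ plug c (subst x (var y) G))
    → (∀ c x G → plug c (cex x G) ≡ F → positive c ≡ false
         → Σ ℕ λ y → (occurs y F ≡ false) × CL2⊢ plug c (subst x (var y) G))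
    → CL2⊢ F
  ruleB1⊓ : ∀ c G₁ G₂ Gs G → positive c ≡ false → G ∈ (G₁ ∷ G₂ ∷ Gs)
    → CL2⊢ plug c G → CL2⊢ plug c (cand G₁ G₂ Gs)
  ruleB1⊔ : ∀ c G₁ G₂ Gs G → positive c ≡ true → G ∈ (G₁ ∷ G₂ ∷ Gs)
    → CL2⊢ plug c G → CL2⊢ plug c (cor G₁ G₂ Gs)
  ruleB2⊓ : ∀ c x G t → positive c ≡ false → B2ok c x G t
    → CL2⊢ plug c (subst x t G) → CL2⊢ plug c (call x G)
  ruleB2⊔ : ∀ c x G t → positive c ≡ true → B2ok c x G t
    → CL2⊢ plug c (subst x t G) → CL2⊢ plug c (cex x G)

{-# OPTIONS --safe #-}

-- Every rule of CL2 has premises with fewer choice operators (⊓, ⊔, ⊓x, ⊔x) than its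
-- conclusion, and a formula has finitely many surface occurrences of choice subformulas, so
-- derivability can be decided by recursion on the number of choice operators once the remaining
-- searches are finite.  Stability is decidable for blind-free F because its elementarization is
-- quantifier-free: truth tables decide it, a falsifying assignment being refuted by the term
-- model and ¬¬-stability of the negative translation turning "true under every assignment" into
-- truth in every structure.  Rule A instantiates a choice quantifier by any fresh variable and
-- Rule B2 by any term; but derivability is invariant under involutive renamings of variables and
-- constants, and swapping two names that do not occur in F leaves F unchanged, so every witness
-- can be traded for one whose name is at most nameBound F, a canonical fresh name.

module Submission where

open import Defs
open import Data.Bool using (Bool; true; false; T; not; _∧_; _∨_; if_then_else_)
open import Data.Bool.Properties using (T-≡; T?; ∧-conicalˡ; ∧-conicalʳ; ∨-zeroʳ) renaming (_≟_ to _≟ᴮ_)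
open import Data.Empty using (⊥-elim)
open import Data.List using (List; []; _∷_; _++_; map; upTo)
import Data.List.Properties as List
open import Data.List.Membership.Propositional using (_∈_)
open import Data.List.Membership.Propositional.Properties using (∈-++⁺ˡ; ∈-++⁺ʳ; ∈-map⁺; ∈-upTo⁺)
open import Data.List.Relation.Unary.All as All using (All)
open import Data.List.Relation.Unary.All.Properties using (map⁺; ++⁺; ++⁻)
open import Data.List.Relation.Unary.Any using (here; there)
open import Data.Nat using (ℕ; suc; _≡ᵇ_; _+_; _<_; _≤_; s≤s; _≤?_)
open import Data.Nat.Induction using (<-wellFounded)
open import Data.Nat.Properties
  using (_≟_; ≡ᵇ⇒≡; ≡⇒≡ᵇ; ≤-refl; ≤-reflexive; ≤-trans; <-≤-trans; <⇒≢; <⇒≤; ≰⇒>;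
         m≤m+n; m≤n+m; m+n≤o⇒m≤o; m+n≤o⇒n≤o; +-monoˡ-<; +-monoʳ-<)
open import Data.Product using (Σ; _×_; _,_; proj₁; proj₂; map₁)
open import Data.Product.Function.NonDependent.Propositional using (_×-⇔_)
import Data.Product.Properties as Product
open import Data.Sum using (_⊎_; inj₁; inj₂)
open import Data.Unit using (tt)
open import Data.Vec using (Vec; _∷_; toList)
open import Function using (_∘_; id)
open import Function.Bundles using (_⇔_; mk⇔; module Equivalence)
open import Function.Related.TypeIsomorphisms using (→-cong-⇔; ¬-cong-⇔)
import Induction.WellFounded as WF
open import Relation.Binary.Construct.On using (wellFounded)
open import Relation.Binary.PropositionalEquality
  using (_≡_; _≢_; refl; sym; trans; cong; cong₂) renaming (subst to transport)
open import Relation.Nullary using (¬_; Dec; yes; no)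
open import Relation.Nullary.Decidable
  using (map′; _×-dec_; _⊎-dec_; _→-dec_; decidable-stable; ¬¬-excluded-middle)
import Relation.Nullary.Decidable as Dec

open Equivalence using (to; from)

≡ᵇ-refl : ∀ n → (n ≡ᵇ n) ≡ true
≡ᵇ-refl n = to T-≡ (≡⇒≡ᵇ n n refl)

≡ᵇ-true⇒≡ : ∀ {m n} → (m ≡ᵇ n) ≡ true → m ≡ n
≡ᵇ-true⇒≡ {m} {n} e = ≡ᵇ⇒≡ m n (from T-≡ e)

≢⇒≡ᵇ-false : ∀ {m n} → m ≢ n → (m ≡ᵇ n) ≡ false
≢⇒≡ᵇ-false {m} {n} m≢n with m ≡ᵇ n in e
... | true  = ⊥-elim (m≢n (≡ᵇ-true⇒≡ e))
... | false = refl

≡ᵇ-injective : ∀ {f : ℕ → ℕ} → (∀ {a b} → f a ≡ f b → a ≡ b) →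
               ∀ a b → (f a ≡ᵇ f b) ≡ (a ≡ᵇ b)
≡ᵇ-injective {f} f-inj a b with a ≟ b
... | yes refl = trans (≡ᵇ-refl (f a)) (sym (≡ᵇ-refl a))
... | no a≢b   = trans (≢⇒≡ᵇ-false (a≢b ∘ f-inj)) (sym (≢⇒≡ᵇ-false a≢b))

∨-trueˡ : ∀ {a} b → a ≡ true → (a ∨ b) ≡ true
∨-trueˡ _ refl = refl

∨-trueʳ : ∀ a {b} → b ≡ true → (a ∨ b) ≡ true
∨-trueʳ a refl = ∨-zeroʳ a

∧-true : ∀ a {b} → (a ∧ b) ≡ true → a ≡ true × b ≡ true
∧-true a {b} e = ∧-conicalˡ a b e , ∧-conicalʳ a b e

∧-intro : ∀ {a b} → a ≡ true → b ≡ true → (a ∧ b) ≡ true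
∧-intro refl refl = refl

cong₃ : ∀ {ℓ} {A B C : Set} {D : Set ℓ} (f : A → B → C → D) {a a′ b b′ c c′} →
        a ≡ a′ → b ≡ b′ → c ≡ c′ → f a b c ≡ f a′ b′ c′
cong₃ f refl refl refl = refl

dec-∀∈ : ∀ {ℓ} {A : Set} {P : A → Set ℓ} (xs : List A) →
         (∀ x → x ∈ xs → Dec (P x)) → Dec (∀ x → x ∈ xs → P x)
dec-∀∈ []       P? = yes (λ _ ())
dec-∀∈ (x ∷ xs) P? =
  map′ (λ (px , pxs) → λ { _ (here refl) → px ; y (there y∈xs) → pxs y y∈xs })
       (λ h → h x (here refl) , λ y y∈xs → h y (there y∈xs))
       (P? x (here refl) ×-dec dec-∀∈ xs (λ y y∈xs → P? y (there y∈xs)))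

dec-∃∈ : ∀ {ℓ} {A : Set} {P : A → Set ℓ} (xs : List A) →
         (∀ x → x ∈ xs → Dec (P x)) → Dec (Σ A λ x → x ∈ xs × P x)
dec-∃∈ []       P? = no (λ { (_ , () , _) })
dec-∃∈ (x ∷ xs) P? =
  map′ (λ { (inj₁ px) → x , here refl , px ; (inj₂ (y , y∈xs , py)) → y , there y∈xs , py })
       (λ { (_ , here refl , px) → inj₁ px ; (y , there y∈xs , py) → inj₂ (y , y∈xs , py) })
       (P? x (here refl) ⊎-dec dec-∃∈ xs (λ y y∈xs → P? y (there y∈xs)))

≡⇒⇔ : ∀ {A B : Set} → A ≡ B → A ⇔ B
≡⇒⇔ refl = mk⇔ id id

Π-cong-⇔ : ∀ {A : Set} {P Q : A → Set} → (∀ a → P a ⇔ Q a) → (∀ a → P a) ⇔ (∀ a → Q a)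
Π-cong-⇔ P⇔Q = mk⇔ (λ f a → to (P⇔Q a) (f a)) (λ g a → from (P⇔Q a) (g a))

cong₅ : ∀ {A B C D E R : Set} (f : A → B → C → D → E → R) {a a′ b b′ c c′ d d′ e e′} →
        a ≡ a′ → b ≡ b′ → c ≡ c′ → d ≡ d′ → e ≡ e′ → f a b c d e ≡ f a′ b′ c′ d′ e′
cong₅ f refl refl refl refl refl = refl

neg-injective : ∀ {F F′ : Formula} → neg F ≡ neg F′ → F ≡ F′
neg-injective refl = refl

and-injective : ∀ {F G F′ G′ : Formula} {Hs Hs′} →
                and F G Hs ≡ and F′ G′ Hs′ → F ≡ F′ × G ≡ G′ × Hs ≡ Hs′
and-injective refl = refl , refl , refl

or-injective : ∀ {F G F′ G′ : Formula} {Hs Hs′} →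
               or F G Hs ≡ or F′ G′ Hs′ → F ≡ F′ × G ≡ G′ × Hs ≡ Hs′
or-injective refl = refl , refl , refl

imp-injective : ∀ {F G F′ G′ : Formula} → imp F G ≡ imp F′ G′ → F ≡ F′ × G ≡ G′
imp-injective refl = refl , refl

all-injective : ∀ {x x′} {F F′ : Formula} → all x F ≡ all x′ F′ → x ≡ x′ × F ≡ F′
all-injective refl = refl , refl

ex-injective : ∀ {x x′} {F F′ : Formula} → ex x F ≡ ex x′ F′ → x ≡ x′ × F ≡ F′
ex-injective refl = refl , refl

call-injective : ∀ {x x′} {F F′ : Formula} → call x F ≡ call x′ F′ → x ≡ x′ × F ≡ F′
call-injective refl = refl , refl

cex-injective : ∀ {x x′} {F F′ : Formula} → cex x F ≡ cex x′ F′ → x ≡ x′ × F ≡ F′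
cex-injective refl = refl , refl

data Kind : Set where
  ⊓ ⊔ : Kind

data Choice : Set where
  alts  : Kind → Formula → Formula → List Formula → Choice
  quant : Kind → ℕ → Formula → Choice

⌜_⌝ : Choice → Formula
⌜ alts ⊓ G₁ G₂ Gs ⌝ = cand G₁ G₂ Gs
⌜ alts ⊔ G₁ G₂ Gs ⌝ = cor G₁ G₂ Gs
⌜ quant ⊓ x G ⌝     = call x G
⌜ quant ⊔ x G ⌝     = cex x G

ruleA-polarity : Kind → Bool
ruleA-polarity ⊓ = true
ruleA-polarity ⊔ = false

EveryAlternative : Ctx → List Formula → Set₁
EveryAlternative c Gs = ∀ G → G ∈ Gs → CL2⊢ plug c G

SomeAlternative : Ctx → List Formula → Set₁
SomeAlternative c Gs = Σ Formula λ G → G ∈ Gs × CL2⊢ plug c G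

FreshInstance : Formula → Ctx → ℕ → Formula → Set₁
FreshInstance F c x G = Σ ℕ λ y → occurs y F ≡ false × CL2⊢ plug c (subst x (var y) G)

SomeInstance : Ctx → ℕ → Formula → Set₁
SomeInstance c x G = Σ Term λ t → B2ok c x G t × CL2⊢ plug c (subst x t G)

RuleA-at : Formula → Ctx → Choice → Set₁
RuleA-at F c (alts k G₁ G₂ Gs) = positive c ≡ ruleA-polarity k → EveryAlternative c (G₁ ∷ G₂ ∷ Gs)
RuleA-at F c (quant k x G)     = positive c ≡ ruleA-polarity k → FreshInstance F c x G

RuleB-at : Ctx → Choice → Set₁
RuleB-at c (alts k G₁ G₂ Gs) = positive c ≡ not (ruleA-polarity k) × SomeAlternative c (G₁ ∷ G₂ ∷ Gs)
RuleB-at c (quant k x G)     = positive c ≡ not (ruleA-polarity k) × SomeInstance c x G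

RuleA-premises : Formula → Set₁
RuleA-premises F = ∀ c X → plug c ⌜ X ⌝ ≡ F → RuleA-at F c X

RuleB-instance : Formula → Set₁
RuleB-instance F = Σ Ctx λ c → Σ Choice λ X → plug c ⌜ X ⌝ ≡ F × RuleB-at c X

LastRule : Formula → Set₁
LastRule F = (Stable F × RuleA-premises F) ⊎ RuleB-instance F

ruleA′ : ∀ {F} → Stable F → RuleA-premises F → CL2⊢ F
ruleA′ st h = ruleA st (λ c G₁ G₂ Gs → h c (alts ⊓ G₁ G₂ Gs)) (λ c G₁ G₂ Gs → h c (alts ⊔ G₁ G₂ Gs))
                       (λ c x G → h c (quant ⊓ x G)) (λ c x G → h c (quant ⊔ x G))

ruleB′ : ∀ {F} → RuleB-instance F → CL2⊢ F
ruleB′ (c , alts ⊓ G₁ G₂ Gs , refl , pos , G , m , d) = ruleB1⊓ c G₁ G₂ Gs G pos m d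
ruleB′ (c , alts ⊔ G₁ G₂ Gs , refl , pos , G , m , d) = ruleB1⊔ c G₁ G₂ Gs G pos m d
ruleB′ (c , quant ⊓ x G , refl , pos , t , ok , d)   = ruleB2⊓ c x G t pos ok d
ruleB′ (c , quant ⊔ x G , refl , pos , t , ok , d)   = ruleB2⊔ c x G t pos ok d

lastRule : ∀ {F} → CL2⊢ F → LastRule F
lastRule (ruleA st a⊓ a⊔ a⊓ˣ a⊔ˣ) = inj₁ (st , premises)
  where
  premises : RuleA-premises _
  premises c (alts ⊓ G₁ G₂ Gs) e = a⊓ c G₁ G₂ Gs e
  premises c (alts ⊔ G₁ G₂ Gs) e = a⊔ c G₁ G₂ Gs e
  premises c (quant ⊓ x G) e     = a⊓ˣ c x G e
  premises c (quant ⊔ x G) e     = a⊔ˣ c x G e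
lastRule (ruleB1⊓ c G₁ G₂ Gs G pos m d) = inj₂ (c , alts ⊓ G₁ G₂ Gs , refl , pos , G , m , d)
lastRule (ruleB1⊔ c G₁ G₂ Gs G pos m d) = inj₂ (c , alts ⊔ G₁ G₂ Gs , refl , pos , G , m , d)
lastRule (ruleB2⊓ c x G t pos ok d)     = inj₂ (c , quant ⊓ x G , refl , pos , t , ok , d)
lastRule (ruleB2⊔ c x G t pos ok d)     = inj₂ (c , quant ⊔ x G , refl , pos , t , ok , d)

lastRule⇔derivable : ∀ {F} → LastRule F ⇔ CL2⊢ F
lastRule⇔derivable = mk⇔ (λ { (inj₁ (st , h)) → ruleA′ st h ; (inj₂ b) → ruleB′ b }) lastRule

mutual
  occurrences : Formula → List (Ctx × Choice)
  occurrences (atom _ _)      = []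
  occurrences top             = []
  occurrences bot             = []
  occurrences (neg F)         = map (map₁ negC) (occurrences F)
  occurrences (and F G Hs)    = map (map₁ λ c → and₀ c G Hs) (occurrences F)
                              ++ map (map₁ λ c → and₁ F c Hs) (occurrences G)
                              ++ occurrencesR (andR F G) Hs
  occurrences (or F G Hs)     = map (map₁ λ c → or₀ c G Hs) (occurrences F)
                              ++ map (map₁ λ c → or₁ F c Hs) (occurrences G)
                              ++ occurrencesR (orR F G) Hs
  occurrences (imp F G)       = map (map₁ λ c → impL c G) (occurrences F) ++ map (map₁ (impR F)) (occurrences G)
  occurrences (cand G₁ G₂ Gs) = (hole , alts ⊓ G₁ G₂ Gs) ∷ []
  occurrences (cor G₁ G₂ Gs)  = (hole , alts ⊔ G₁ G₂ Gs) ∷ []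
  occurrences (all z F)       = map (map₁ (allC z)) (occurrences F)
  occurrences (ex z F)        = map (map₁ (exC z)) (occurrences F)
  occurrences (call x G)      = (hole , quant ⊓ x G) ∷ []
  occurrences (cex x G)       = (hole , quant ⊔ x G) ∷ []

  -- k ls c rs is the context of a hole between the extra arguments ls and rs of an n-ary ∧ or ∨
  occurrencesR : (List Formula → Ctx → List Formula → Ctx) → List Formula → List (Ctx × Choice)
  occurrencesR k []       = []
  occurrencesR k (H ∷ Hs) = map (map₁ λ c → k [] c Hs) (occurrences H) ++ occurrencesR (λ ls → k (H ∷ ls)) Hs

OccursIn : Formula → Ctx × Choice → Set
OccursIn F o = plug (proj₁ o) ⌜ proj₂ o ⌝ ≡ F

mutual
  occurrences-sound : ∀ F → All (OccursIn F) (occurrences F)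
  occurrences-sound (atom _ _)      = All.[]
  occurrences-sound top             = All.[]
  occurrences-sound bot             = All.[]
  occurrences-sound (neg F)         = map⁺ (All.map (cong neg) (occurrences-sound F))
  occurrences-sound (and F G Hs)    = ++⁺ (map⁺ (All.map (cong λ Y → and Y G Hs) (occurrences-sound F)))
                                     (++⁺ (map⁺ (All.map (cong λ Y → and F Y Hs) (occurrences-sound G)))
                                          (occurrencesR-sound (andR F G) (and F G) (λ _ _ _ _ → refl) Hs))
  occurrences-sound (or F G Hs)     = ++⁺ (map⁺ (All.map (cong λ Y → or Y G Hs) (occurrences-sound F)))
                                     (++⁺ (map⁺ (All.map (cong λ Y → or F Y Hs) (occurrences-sound G)))
                                          (occurrencesR-sound (orR F G) (or F G) (λ _ _ _ _ → refl) Hs))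
  occurrences-sound (imp F G)       = ++⁺ (map⁺ (All.map (cong λ Y → imp Y G) (occurrences-sound F)))
                                          (map⁺ (All.map (cong (imp F)) (occurrences-sound G)))
  occurrences-sound (cand G₁ G₂ Gs) = refl All.∷ All.[]
  occurrences-sound (cor G₁ G₂ Gs)  = refl All.∷ All.[]
  occurrences-sound (all z F)       = map⁺ (All.map (cong (all z)) (occurrences-sound F))
  occurrences-sound (ex z F)        = map⁺ (All.map (cong (ex z)) (occurrences-sound F))
  occurrences-sound (call x G)      = refl All.∷ All.[]
  occurrences-sound (cex x G)       = refl All.∷ All.[]

  occurrencesR-sound : ∀ k (T : List Formula → Formula) →
                       (∀ ls c rs X → plug (k ls c rs) X ≡ T (ls ++ plug c X ∷ rs)) →
                       ∀ Hs → All (OccursIn (T Hs)) (occurrencesR k Hs)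
  occurrencesR-sound k T kT []       = All.[]
  occurrencesR-sound k T kT (H ∷ Hs) =
    ++⁺ (map⁺ (All.map (λ {o} e → trans (kT [] (proj₁ o) Hs _) (cong (λ Y → T (Y ∷ Hs)) e))
                       (occurrences-sound H)))
        (occurrencesR-sound (λ ls → k (H ∷ ls)) (λ ls → T (H ∷ ls)) (λ ls → kT (H ∷ ls)) Hs)

occurrencesR-complete : ∀ k ls H rs {o} → o ∈ occurrences H →
                        map₁ (λ c → k ls c rs) o ∈ occurrencesR k (ls ++ H ∷ rs)
occurrencesR-complete k []       H rs m = ∈-++⁺ˡ (∈-map⁺ _ m)
occurrencesR-complete k (l ∷ ls) H rs m =
  ∈-++⁺ʳ (map (map₁ λ c → k [] c (ls ++ H ∷ rs)) (occurrences l))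
         (occurrencesR-complete (λ ls′ → k (l ∷ ls′)) ls H rs m)

occurrences-complete : ∀ c X → (c , X) ∈ occurrences (plug c ⌜ X ⌝)
occurrences-complete hole (alts ⊓ _ _ _) = here refl
occurrences-complete hole (alts ⊔ _ _ _) = here refl
occurrences-complete hole (quant ⊓ _ _)  = here refl
occurrences-complete hole (quant ⊔ _ _)  = here refl
occurrences-complete (negC c) X          = ∈-map⁺ _ (occurrences-complete c X)
occurrences-complete (and₀ c G Hs) X     = ∈-++⁺ˡ (∈-map⁺ _ (occurrences-complete c X))
occurrences-complete (and₁ F c Hs) X     =
  ∈-++⁺ʳ (map (map₁ λ c′ → and₀ c′ (plug c ⌜ X ⌝) Hs) (occurrences F))
         (∈-++⁺ˡ (∈-map⁺ _ (occurrences-complete c X)))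
occurrences-complete (andR F G ls c rs) X =
  ∈-++⁺ʳ (map (map₁ λ c′ → and₀ c′ G Hs) (occurrences F))
         (∈-++⁺ʳ (map (map₁ λ c′ → and₁ F c′ Hs) (occurrences G))
                 (occurrencesR-complete (andR F G) ls (plug c ⌜ X ⌝) rs (occurrences-complete c X)))
  where
  Hs : List Formula
  Hs = ls ++ plug c ⌜ X ⌝ ∷ rs
occurrences-complete (or₀ c G Hs) X      = ∈-++⁺ˡ (∈-map⁺ _ (occurrences-complete c X))
occurrences-complete (or₁ F c Hs) X      =
  ∈-++⁺ʳ (map (map₁ λ c′ → or₀ c′ (plug c ⌜ X ⌝) Hs) (occurrences F))
         (∈-++⁺ˡ (∈-map⁺ _ (occurrences-complete c X)))
occurrences-complete (orR F G ls c rs) X =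
  ∈-++⁺ʳ (map (map₁ λ c′ → or₀ c′ G Hs) (occurrences F))
         (∈-++⁺ʳ (map (map₁ λ c′ → or₁ F c′ Hs) (occurrences G))
                 (occurrencesR-complete (orR F G) ls (plug c ⌜ X ⌝) rs (occurrences-complete c X)))
  where
  Hs : List Formula
  Hs = ls ++ plug c ⌜ X ⌝ ∷ rs
occurrences-complete (impL c G) X        = ∈-++⁺ˡ (∈-map⁺ _ (occurrences-complete c X))
occurrences-complete (impR F c) X        =
  ∈-++⁺ʳ (map (map₁ λ c′ → impL c′ (plug c ⌜ X ⌝)) (occurrences F))
         (∈-map⁺ _ (occurrences-complete c X))
occurrences-complete (allC z c) X        = ∈-map⁺ _ (occurrences-complete c X)
occurrences-complete (exC z c) X         = ∈-map⁺ _ (occurrences-complete c X)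

∈-occurrences⇔ : ∀ {F c X} → (c , X) ∈ occurrences F ⇔ plug c ⌜ X ⌝ ≡ F
∈-occurrences⇔ {F} {c} {X} = mk⇔ (All.lookup (occurrences-sound F)) λ { refl → occurrences-complete c X }

module _ {ℓ} {P : Ctx → Choice → Set ℓ} (F : Formula)
         (P? : ∀ c X → plug c ⌜ X ⌝ ≡ F → Dec (P c X)) where

  dec-∀-occurrence : Dec (∀ c X → plug c ⌜ X ⌝ ≡ F → P c X)
  dec-∀-occurrence =
    map′ (λ h c X e → h (c , X) (from ∈-occurrences⇔ e)) (λ h (c , X) m → h c X (to ∈-occurrences⇔ m))
         (dec-∀∈ (occurrences F) λ (c , X) m → P? c X (to ∈-occurrences⇔ m))

  dec-∃-occurrence : Dec (Σ Ctx λ c → Σ Choice λ X → plug c ⌜ X ⌝ ≡ F × P c X)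
  dec-∃-occurrence =
    map′ (λ ((c , X) , m , p) → c , X , to ∈-occurrences⇔ m , p)
         (λ (c , X , e , p) → (c , X) , from ∈-occurrences⇔ e , p)
         (dec-∃∈ (occurrences F) λ (c , X) m → P? c X (to ∈-occurrences⇔ m))

mutual
  choices : Formula → ℕ
  choices (atom _ _)    = 0
  choices top           = 0
  choices bot           = 0
  choices (neg F)       = choices F
  choices (and F G Hs)  = choices F + (choices G + choicesL Hs)
  choices (or F G Hs)   = choices F + (choices G + choicesL Hs)
  choices (imp F G)     = choices F + choices G
  choices (cand F G Hs) = suc (choices F + (choices G + choicesL Hs))
  choices (cor F G Hs)  = suc (choices F + (choices G + choicesL Hs))
  choices (all _ F)     = choices F
  choices (ex _ F)      = choices F
  choices (call _ F)    = suc (choices F)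
  choices (cex _ F)     = suc (choices F)

  choicesL : List Formula → ℕ
  choicesL []       = 0
  choicesL (F ∷ Fs) = choices F + choicesL Fs

mutual
  choices-subst : ∀ x t F → choices (subst x t F) ≡ choices F
  choices-subst x t (atom p ts)   = refl
  choices-subst x t top           = refl
  choices-subst x t bot           = refl
  choices-subst x t (neg F)       = choices-subst x t F
  choices-subst x t (and F G Hs) =
    cong₃ (λ a b c → a + (b + c)) (choices-subst x t F) (choices-subst x t G) (choicesL-substs x t Hs)
  choices-subst x t (or F G Hs) =
    cong₃ (λ a b c → a + (b + c)) (choices-subst x t F) (choices-subst x t G) (choicesL-substs x t Hs)
  choices-subst x t (imp F G)     = cong₂ _+_ (choices-subst x t F) (choices-subst x t G)
  choices-subst x t (cand F G Hs) =
    cong₃ (λ a b c → suc (a + (b + c))) (choices-subst x t F) (choices-subst x t G) (choicesL-substs x t Hs)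
  choices-subst x t (cor F G Hs) =
    cong₃ (λ a b c → suc (a + (b + c))) (choices-subst x t F) (choices-subst x t G) (choicesL-substs x t Hs)
  choices-subst x t (all z F) with z ≡ᵇ x
  ... | true  = refl
  ... | false = choices-subst x t F
  choices-subst x t (ex z F) with z ≡ᵇ x
  ... | true  = refl
  ... | false = choices-subst x t F
  choices-subst x t (call z F) with z ≡ᵇ x
  ... | true  = refl
  ... | false = cong suc (choices-subst x t F)
  choices-subst x t (cex z F) with z ≡ᵇ x
  ... | true  = refl
  ... | false = cong suc (choices-subst x t F)

  choicesL-substs : ∀ x t Fs → choicesL (substs x t Fs) ≡ choicesL Fs
  choicesL-substs x t []       = refl
  choicesL-substs x t (F ∷ Fs) = cong₂ _+_ (choices-subst x t F) (choicesL-substs x t Fs)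

choicesL-mid : ∀ ls rs {X Y} → choices Y < choices X → choicesL (ls ++ Y ∷ rs) < choicesL (ls ++ X ∷ rs)
choicesL-mid []       rs lt = +-monoˡ-< (choicesL rs) lt
choicesL-mid (l ∷ ls) rs lt = +-monoʳ-< (choices l) (choicesL-mid ls rs lt)

choices-plug : ∀ c {X Y} → choices Y < choices X → choices (plug c Y) < choices (plug c X)
choices-plug hole               lt = lt
choices-plug (negC c)           lt = choices-plug c lt
choices-plug (and₀ c G Hs)      lt = +-monoˡ-< _ (choices-plug c lt)
choices-plug (and₁ F c Hs)      lt = +-monoʳ-< (choices F) (+-monoˡ-< _ (choices-plug c lt))
choices-plug (andR F G ls c rs) lt =
  +-monoʳ-< (choices F) (+-monoʳ-< (choices G) (choicesL-mid ls rs (choices-plug c lt)))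
choices-plug (or₀ c G Hs)       lt = +-monoˡ-< _ (choices-plug c lt)
choices-plug (or₁ F c Hs)       lt = +-monoʳ-< (choices F) (+-monoˡ-< _ (choices-plug c lt))
choices-plug (orR F G ls c rs)  lt =
  +-monoʳ-< (choices F) (+-monoʳ-< (choices G) (choicesL-mid ls rs (choices-plug c lt)))
choices-plug (impL c G)         lt = +-monoˡ-< _ (choices-plug c lt)
choices-plug (impR F c)         lt = +-monoʳ-< (choices F) (choices-plug c lt)
choices-plug (allC z c)         lt = choices-plug c lt
choices-plug (exC z c)          lt = choices-plug c lt

choices-∈ : ∀ {G Gs} → G ∈ Gs → choices G ≤ choicesL Gs
choices-∈ {G} {_ ∷ Gs} (here refl) = m≤m+n (choices G) (choicesL Gs)
choices-∈ {G} {H ∷ Gs} (there m)   = ≤-trans (choices-∈ m) (m≤n+m (choicesL Gs) (choices H))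

choices-alternative : ∀ k {G₁ G₂ Gs G} → G ∈ G₁ ∷ G₂ ∷ Gs → choices G < choices ⌜ alts k G₁ G₂ Gs ⌝
choices-alternative ⊓ m = s≤s (choices-∈ m)
choices-alternative ⊔ m = s≤s (choices-∈ m)

choices-instance : ∀ k x G t → choices (subst x t G) < choices ⌜ quant k x G ⌝
choices-instance ⊓ x G t = s≤s (≤-reflexive (choices-subst x t G))
choices-instance ⊔ x G t = s≤s (≤-reflexive (choices-subst x t G))

premise-choices : ∀ c X Y {F} → plug c X ≡ F → choices Y < choices X → choices (plug c Y) < choices F
premise-choices c X Y refl = choices-plug c

mutual
  blindFree-subst : ∀ x t F → blindFree (subst x t F) ≡ blindFree F
  blindFree-subst x t (atom p ts)   = refl
  blindFree-subst x t top           = refl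
  blindFree-subst x t bot           = refl
  blindFree-subst x t (neg F)       = blindFree-subst x t F
  blindFree-subst x t (and F G Hs) =
    cong₃ (λ a b c → a ∧ b ∧ c) (blindFree-subst x t F) (blindFree-subst x t G) (blindFreeL-substs x t Hs)
  blindFree-subst x t (or F G Hs) =
    cong₃ (λ a b c → a ∧ b ∧ c) (blindFree-subst x t F) (blindFree-subst x t G) (blindFreeL-substs x t Hs)
  blindFree-subst x t (imp F G)     = cong₂ _∧_ (blindFree-subst x t F) (blindFree-subst x t G)
  blindFree-subst x t (cand F G Hs) =
    cong₃ (λ a b c → a ∧ b ∧ c) (blindFree-subst x t F) (blindFree-subst x t G) (blindFreeL-substs x t Hs)
  blindFree-subst x t (cor F G Hs) =
    cong₃ (λ a b c → a ∧ b ∧ c) (blindFree-subst x t F) (blindFree-subst x t G) (blindFreeL-substs x t Hs)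
  blindFree-subst x t (all z F) with z ≡ᵇ x
  ... | true  = refl
  ... | false = refl
  blindFree-subst x t (ex z F) with z ≡ᵇ x
  ... | true  = refl
  ... | false = refl
  blindFree-subst x t (call z F) with z ≡ᵇ x
  ... | true  = refl
  ... | false = blindFree-subst x t F
  blindFree-subst x t (cex z F) with z ≡ᵇ x
  ... | true  = refl
  ... | false = blindFree-subst x t F

  blindFreeL-substs : ∀ x t Fs → blindFreeL (substs x t Fs) ≡ blindFreeL Fs
  blindFreeL-substs x t []       = refl
  blindFreeL-substs x t (F ∷ Fs) = cong₂ _∧_ (blindFree-subst x t F) (blindFreeL-substs x t Fs)

blindFreeL-mid : ∀ ls rs X Y → blindFreeL (ls ++ X ∷ rs) ≡ true →
                 blindFree X ≡ true × (blindFree Y ≡ true → blindFreeL (ls ++ Y ∷ rs) ≡ true)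
blindFreeL-mid []       rs X Y h = let (bX , brs) = ∧-true (blindFree X) h in bX , λ bY → ∧-intro bY brs
blindFreeL-mid (l ∷ ls) rs X Y h =
  let (bl , bmid) = ∧-true (blindFree l) h ; (bX , replace) = blindFreeL-mid ls rs X Y bmid
  in bX , λ bY → ∧-intro bl (replace bY)

blindFree-plug : ∀ c X Y → blindFree (plug c X) ≡ true →
                 blindFree X ≡ true × (blindFree Y ≡ true → blindFree (plug c Y) ≡ true)
blindFree-plug hole X Y h = h , λ bY → bY
blindFree-plug (negC c) X Y h = blindFree-plug c X Y h
blindFree-plug (and₀ c G Hs) X Y h =
  let (b₁ , b₂) = ∧-true (blindFree (plug c X)) h ; (bX , replace) = blindFree-plug c X Y b₁
  in bX , λ bY → ∧-intro (replace bY) b₂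
blindFree-plug (and₁ F c Hs) X Y h =
  let (b₁ , b₂₃) = ∧-true (blindFree F) h ; (b₂ , b₃) = ∧-true (blindFree (plug c X)) b₂₃
      (bX , replace) = blindFree-plug c X Y b₂
  in bX , λ bY → ∧-intro b₁ (∧-intro (replace bY) b₃)
blindFree-plug (andR F G ls c rs) X Y h =
  let (b₁ , b₂₃) = ∧-true (blindFree F) h ; (b₂ , b₃) = ∧-true (blindFree G) b₂₃
      (bcX , replaceL) = blindFreeL-mid ls rs (plug c X) (plug c Y) b₃
      (bX , replace) = blindFree-plug c X Y bcX
  in bX , λ bY → ∧-intro b₁ (∧-intro b₂ (replaceL (replace bY)))
blindFree-plug (or₀ c G Hs) X Y h =
  let (b₁ , b₂) = ∧-true (blindFree (plug c X)) h ; (bX , replace) = blindFree-plug c X Y b₁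
  in bX , λ bY → ∧-intro (replace bY) b₂
blindFree-plug (or₁ F c Hs) X Y h =
  let (b₁ , b₂₃) = ∧-true (blindFree F) h ; (b₂ , b₃) = ∧-true (blindFree (plug c X)) b₂₃
      (bX , replace) = blindFree-plug c X Y b₂
  in bX , λ bY → ∧-intro b₁ (∧-intro (replace bY) b₃)
blindFree-plug (orR F G ls c rs) X Y h =
  let (b₁ , b₂₃) = ∧-true (blindFree F) h ; (b₂ , b₃) = ∧-true (blindFree G) b₂₃
      (bcX , replaceL) = blindFreeL-mid ls rs (plug c X) (plug c Y) b₃
      (bX , replace) = blindFree-plug c X Y bcX
  in bX , λ bY → ∧-intro b₁ (∧-intro b₂ (replaceL (replace bY)))
blindFree-plug (impL c G) X Y h =
  let (b₁ , b₂) = ∧-true (blindFree (plug c X)) h ; (bX , replace) = blindFree-plug c X Y b₁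
  in bX , λ bY → ∧-intro (replace bY) b₂
blindFree-plug (impR F c) X Y h =
  let (b₁ , b₂) = ∧-true (blindFree F) h ; (bX , replace) = blindFree-plug c X Y b₂
  in bX , λ bY → ∧-intro b₁ (replace bY)
blindFree-plug (allC z c) X Y ()
blindFree-plug (exC z c)  X Y ()

blindFree-∈ : ∀ {G Gs} → G ∈ Gs → blindFreeL Gs ≡ true → blindFree G ≡ true
blindFree-∈ {G} (here refl) h = proj₁ (∧-true (blindFree G) h)
blindFree-∈ {Gs = H ∷ _} (there m) h = blindFree-∈ m (proj₂ (∧-true (blindFree H) h))

blindFree-alternative : ∀ k {G₁ G₂ Gs G} → G ∈ G₁ ∷ G₂ ∷ Gs →
                        blindFree ⌜ alts k G₁ G₂ Gs ⌝ ≡ true → blindFree G ≡ true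
blindFree-alternative ⊓ m = blindFree-∈ m
blindFree-alternative ⊔ m = blindFree-∈ m

blindFree-instance : ∀ k x G t → blindFree ⌜ quant k x G ⌝ ≡ true → blindFree (subst x t G) ≡ true
blindFree-instance ⊓ x G t = trans (blindFree-subst x t G)
blindFree-instance ⊔ x G t = trans (blindFree-subst x t G)

premise-blindFree : ∀ c X Y {F} → plug c X ≡ F → blindFree F ≡ true →
                    (blindFree X ≡ true → blindFree Y ≡ true) → blindFree (plug c Y) ≡ true
premise-blindFree c X Y refl bF bX⇒bY =
  let (bX , replace) = blindFree-plug c X Y bF in replace (bX⇒bY bX)

-- Deciding stability by truth tables

data QuantifierFree : CFormula → Set where
  atom : ∀ {p ts} → QuantifierFree (atom p ts)
  top  : QuantifierFree top
  bot  : QuantifierFree bot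
  neg  : ∀ {φ} → QuantifierFree φ → QuantifierFree (neg φ)
  and  : ∀ {φ ψ χs} → QuantifierFree φ → QuantifierFree ψ → All QuantifierFree χs →
         QuantifierFree (and φ ψ χs)
  or   : ∀ {φ ψ χs} → QuantifierFree φ → QuantifierFree ψ → All QuantifierFree χs →
         QuantifierFree (or φ ψ χs)
  imp  : ∀ {φ ψ} → QuantifierFree φ → QuantifierFree ψ → QuantifierFree (imp φ ψ)

mutual
  elem-quantifierFree : ∀ F → blindFree F ≡ true → QuantifierFree (elem F)
  elem-quantifierFree (atom p ts)   _ = atom
  elem-quantifierFree top           _ = top
  elem-quantifierFree bot           _ = bot
  elem-quantifierFree (neg F)       h = neg (elem-quantifierFree F h)
  elem-quantifierFree (and F G Hs)  h =
    let (hF , hGHs) = ∧-true (blindFree F) h ; (hG , hHs) = ∧-true (blindFree G) hGHs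
    in and (elem-quantifierFree F hF) (elem-quantifierFree G hG) (elemL-quantifierFree Hs hHs)
  elem-quantifierFree (or F G Hs)   h =
    let (hF , hGHs) = ∧-true (blindFree F) h ; (hG , hHs) = ∧-true (blindFree G) hGHs
    in or (elem-quantifierFree F hF) (elem-quantifierFree G hG) (elemL-quantifierFree Hs hHs)
  elem-quantifierFree (imp F G)     h =
    let (hF , hG) = ∧-true (blindFree F) h in imp (elem-quantifierFree F hF) (elem-quantifierFree G hG)
  elem-quantifierFree (cand _ _ _)  _ = top
  elem-quantifierFree (cor _ _ _)   _ = bot
  elem-quantifierFree (call _ _)    _ = top
  elem-quantifierFree (cex _ _)     _ = bot

  elemL-quantifierFree : ∀ Fs → blindFreeL Fs ≡ true → All QuantifierFree (elemL Fs)
  elemL-quantifierFree []       _ = All.[]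
  elemL-quantifierFree (F ∷ Fs) h =
    let (hF , hFs) = ∧-true (blindFree F) h in elem-quantifierFree F hF All.∷ elemL-quantifierFree Fs hFs

Key : Set
Key = ℕ × List Term

Assignment : Set
Assignment = ℕ → List Term → Bool

mutual
  evalB : ∀ {φ} → Assignment → QuantifierFree φ → Bool
  evalB {atom p ts} β atom = β p ts
  evalB β top              = true
  evalB β bot              = false
  evalB β (neg φ)          = not (evalB β φ)
  evalB β (and φ ψ χs)     = evalB β φ ∧ evalB β ψ ∧ allB β χs
  evalB β (or φ ψ χs)      = not (not (evalB β φ) ∧ not (evalB β ψ) ∧ noneB β χs)
  evalB β (imp φ ψ)        = not (evalB β φ) ∨ evalB β ψ

  allB : ∀ {φs} → Assignment → All QuantifierFree φs → Bool
  allB β All.[]         = true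
  allB β (φ All.∷ φs)   = evalB β φ ∧ allB β φs

  noneB : ∀ {φs} → Assignment → All QuantifierFree φs → Bool
  noneB β All.[]        = true
  noneB β (φ All.∷ φs)  = not (evalB β φ) ∧ noneB β φs

mutual
  atoms : CFormula → List Key
  atoms (atom p ts)  = (p , ts) ∷ []
  atoms top          = []
  atoms bot          = []
  atoms (neg φ)      = atoms φ
  atoms (and φ ψ χs) = atoms φ ++ atoms ψ ++ atomsL χs
  atoms (or φ ψ χs)  = atoms φ ++ atoms ψ ++ atomsL χs
  atoms (imp φ ψ)    = atoms φ ++ atoms ψ
  atoms (all _ _)    = []
  atoms (ex _ _)     = []

  atomsL : List CFormula → List Key
  atomsL []       = []
  atomsL (φ ∷ φs) = atoms φ ++ atomsL φs

_≈ᵇ_ : Set → Bool → Set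
A ≈ᵇ b = A ⇔ T b

¬-≈ᵇ : ∀ {A a} → A ≈ᵇ a → (¬ A) ≈ᵇ not a
¬-≈ᵇ {a = true}  A⇔a = mk⇔ (λ ¬A → ¬A (from A⇔a tt)) (λ ())
¬-≈ᵇ {a = false} A⇔a = mk⇔ (λ _ → tt) (λ _ → to A⇔a)

×-≈ᵇ : ∀ {A B a b} → A ≈ᵇ a → B ≈ᵇ b → (A × B) ≈ᵇ (a ∧ b)
×-≈ᵇ {a = true}  A⇔a B⇔b = mk⇔ (λ (_ , y) → to B⇔b y) (λ t → from A⇔a tt , from B⇔b t)
×-≈ᵇ {a = false} A⇔a B⇔b = mk⇔ (λ (x , _) → to A⇔a x) (λ ())

→-≈ᵇ : ∀ {A B a b} → A ≈ᵇ a → B ≈ᵇ b → (A → B) ≈ᵇ (not a ∨ b)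
→-≈ᵇ {a = true}  A⇔a B⇔b = mk⇔ (λ f → to B⇔b (f (from A⇔a tt))) (λ t _ → from B⇔b t)
→-≈ᵇ {a = false} A⇔a B⇔b = mk⇔ (λ _ → tt) (λ _ x → ⊥-elim (to A⇔a x))

_≟ᵀ_ : (s t : Term) → Dec (s ≡ t)
var x ≟ᵀ var y = map′ (cong var) (λ { refl → refl }) (x ≟ y)
var x ≟ᵀ con k = no (λ ())
con k ≟ᵀ var x = no (λ ())
con k ≟ᵀ con n = map′ (cong con) (λ { refl → refl }) (k ≟ n)

_≟ᴷ_ : (k k′ : Key) → Dec (k ≡ k′)
_≟ᴷ_ = Product.≡-dec _≟_ (List.≡-dec _≟ᵀ_)

set : Key → Bool → Assignment → Assignment
set k b β p ts with k ≟ᴷ (p , ts)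
... | yes _ = b
... | no _  = β p ts

assignments : List Key → List Assignment
assignments []       = (λ _ _ → false) ∷ []
assignments (k ∷ ks) = map (set k true) (assignments ks) ++ map (set k false) (assignments ks)

module _ (M : Structure) where

  mutual
    Tr-stable : ∀ {ρ} φ → ¬ ¬ Tr M ρ φ → Tr M ρ φ
    Tr-stable (atom p ts)  ¬¬t = λ ¬p → ¬¬t (λ t → t ¬p)
    Tr-stable top          _   = tt
    Tr-stable bot          ¬¬t = ¬¬t id
    Tr-stable (neg φ)      ¬¬t = λ t → ¬¬t (λ ¬t → ¬t t)
    Tr-stable (and φ ψ χs) ¬¬t = Tr-stable φ (λ ¬t → ¬¬t (¬t ∘ proj₁))
                               , Tr-stable ψ (λ ¬t → ¬¬t (¬t ∘ proj₁ ∘ proj₂))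
                               , TrAll-stable χs (λ ¬t → ¬¬t (¬t ∘ proj₂ ∘ proj₂))
    Tr-stable (or φ ψ χs)  ¬¬t = λ t → ¬¬t (λ ¬t → ¬t t)
    Tr-stable (imp φ ψ)    ¬¬t = λ a → Tr-stable ψ (λ ¬t → ¬¬t (λ f → ¬t (f a)))
    Tr-stable (all x φ)    ¬¬t = λ d → Tr-stable φ (λ ¬t → ¬¬t (λ f → ¬t (f d)))
    Tr-stable (ex x φ)     ¬¬t = λ t → ¬¬t (λ ¬t → ¬t t)

    TrAll-stable : ∀ {ρ} φs → ¬ ¬ TrAll M ρ φs → TrAll M ρ φs
    TrAll-stable []       _   = tt
    TrAll-stable (φ ∷ φs) ¬¬t =
      Tr-stable φ (λ ¬t → ¬¬t (¬t ∘ proj₁)) , TrAll-stable φs (λ ¬t → ¬¬t (¬t ∘ proj₂))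

  module _ (ρ : ℕ → Structure.D M) where

    TrKey : Key → Set
    TrKey (p , ts) = Tr M ρ (atom p ts)

    AgreesOn : Assignment → Key → Set
    AgreesOn β (p , ts) = TrKey (p , ts) ≈ᵇ β p ts

    mutual
      Tr-evalB : ∀ {φ β} (qf : QuantifierFree φ) → All (AgreesOn β) (atoms φ) → Tr M ρ φ ≈ᵇ evalB β qf
      Tr-evalB atom         ag = All.head ag
      Tr-evalB top          ag = mk⇔ (λ _ → tt) (λ _ → tt)
      Tr-evalB bot          ag = mk⇔ id id
      Tr-evalB (neg φ)      ag = ¬-≈ᵇ (Tr-evalB φ ag)
      Tr-evalB {and φ ψ χs} (and qφ qψ qχs) ag =
        let (agφ , agψχs) = ++⁻ (atoms φ) ag ; (agψ , agχs) = ++⁻ (atoms ψ) agψχs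
        in ×-≈ᵇ (Tr-evalB qφ agφ) (×-≈ᵇ (Tr-evalB qψ agψ) (TrAll-allB qχs agχs))
      Tr-evalB {or φ ψ χs} (or qφ qψ qχs) ag =
        let (agφ , agψχs) = ++⁻ (atoms φ) ag ; (agψ , agχs) = ++⁻ (atoms ψ) agψχs
        in ¬-≈ᵇ (×-≈ᵇ (¬-≈ᵇ (Tr-evalB qφ agφ))
                      (×-≈ᵇ (¬-≈ᵇ (Tr-evalB qψ agψ)) (NoneTr-noneB qχs agχs)))
      Tr-evalB {imp φ ψ} (imp qφ qψ) ag =
        let (agφ , agψ) = ++⁻ (atoms φ) ag in →-≈ᵇ (Tr-evalB qφ agφ) (Tr-evalB qψ agψ)

      TrAll-allB : ∀ {φs β} (qfs : All QuantifierFree φs) → All (AgreesOn β) (atomsL φs) →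
                   TrAll M ρ φs ≈ᵇ allB β qfs
      TrAll-allB All.[] _ = mk⇔ (λ _ → tt) (λ _ → tt)
      TrAll-allB {φ ∷ _} (qφ All.∷ qφs) ag =
        let (agφ , agφs) = ++⁻ (atoms φ) ag in ×-≈ᵇ (Tr-evalB qφ agφ) (TrAll-allB qφs agφs)

      NoneTr-noneB : ∀ {φs β} (qfs : All QuantifierFree φs) → All (AgreesOn β) (atomsL φs) →
                     NoneTr M ρ φs ≈ᵇ noneB β qfs
      NoneTr-noneB All.[] _ = mk⇔ (λ _ → tt) (λ _ → tt)
      NoneTr-noneB {φ ∷ _} (qφ All.∷ qφs) ag =
        let (agφ , agφs) = ++⁻ (atoms φ) ag in ×-≈ᵇ (¬-≈ᵇ (Tr-evalB qφ agφ)) (NoneTr-noneB qφs agφs)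

    agreesOn-set : ∀ {β b} k → TrKey k ≈ᵇ b →
                   ∀ k′ → (k ≢ k′ → AgreesOn β k′) → AgreesOn (set k b β) k′
    agreesOn-set k h (p′ , ts′) ag with k ≟ᴷ (p′ , ts′)
    ... | yes refl = h
    ... | no k≢k′  = ag k≢k′

    agreeing-assignment : ∀ ks → ¬ ¬ Σ Assignment λ β → β ∈ assignments ks × All (AgreesOn β) ks
    agreeing-assignment []       ¬β = ¬β ((λ _ _ → false) , here refl , All.[])
    agreeing-assignment (k ∷ ks) ¬β = agreeing-assignment ks λ (β , β∈ , ag) →
      ¬¬-excluded-middle {A = TrKey k} λ
        { (yes t) → ¬β (set k true β , ∈-++⁺ˡ (∈-map⁺ (set k true) β∈)
                       , extend ag (mk⇔ (λ _ → tt) (λ _ → t)))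
        ; (no ¬t) → ¬β (set k false β
                       , ∈-++⁺ʳ (map (set k true) (assignments ks)) (∈-map⁺ (set k false) β∈)
                       , extend ag (mk⇔ ¬t (λ ()))) }
      where
      extend : ∀ {β b} → All (AgreesOn β) ks → TrKey k ≈ᵇ b → All (AgreesOn (set k b β)) (k ∷ ks)
      extend ag h = agreesOn-set k h k (λ k≢k → ⊥-elim (k≢k refl))
               All.∷ All.map (λ {k′} a → agreesOn-set k h k′ (λ _ → a)) ag

termModel : Assignment → Structure
termModel β = record { D = Term ; d₀ = var 0 ; pred = λ p _ v → T (β p (toList v)) ; const = con }

toList-evalTs : ∀ β ts → toList (evalTs (termModel β) var ts) ≡ ts
toList-evalTs β []           = refl
toList-evalTs β (var x ∷ ts) = cong (var x ∷_) (toList-evalTs β ts)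
toList-evalTs β (con k ∷ ts) = cong (con k ∷_) (toList-evalTs β ts)

termModel-agrees : ∀ β ks → All (AgreesOn (termModel β) var β) ks
termModel-agrees β = All.universal agrees
  where
  agrees : ∀ k → AgreesOn (termModel β) var β k
  agrees (p , ts) rewrite toList-evalTs β ts = mk⇔ (decidable-stable (T? _)) (λ t ¬t → ¬t t)

valid? : ∀ {φ} → QuantifierFree φ → Dec (Valid φ)
valid? {φ} qf = map′ sound complete (dec-∀∈ (assignments (atoms φ)) λ β _ → T? (evalB β qf))
  where
  sound : (∀ β → β ∈ assignments (atoms φ) → T (evalB β qf)) → Valid φ
  sound h M ρ = Tr-stable M φ λ ¬t → agreeing-assignment M ρ (atoms φ) λ (β , β∈ , ag) →
    ¬t (from (Tr-evalB M ρ qf ag) (h β β∈))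

  complete : Valid φ → ∀ β → β ∈ assignments (atoms φ) → T (evalB β qf)
  complete v β _ = to (Tr-evalB (termModel β) var qf (termModel-agrees β (atoms φ))) (v (termModel β) var)

stable? : ∀ F → blindFree F ≡ true → Dec (Stable F)
stable? F bf = valid? (elem-quantifierFree F bf)

-- Invariance of derivability under renaming

termBound : Term → ℕ
termBound (var x) = suc x
termBound (con k) = suc k

termsBound : List Term → ℕ
termsBound []       = 0
termsBound (t ∷ ts) = termBound t + termsBound ts

mutual
  nameBound : Formula → ℕ
  nameBound (atom p ts)   = termsBound ts
  nameBound top           = 0
  nameBound bot           = 0
  nameBound (neg F)       = nameBound F
  nameBound (and F G Hs)  = nameBound F + (nameBound G + nameBoundL Hs)
  nameBound (or F G Hs)   = nameBound F + (nameBound G + nameBoundL Hs)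
  nameBound (imp F G)     = nameBound F + nameBound G
  nameBound (cand F G Hs) = nameBound F + (nameBound G + nameBoundL Hs)
  nameBound (cor F G Hs)  = nameBound F + (nameBound G + nameBoundL Hs)
  nameBound (all z F)     = suc z + nameBound F
  nameBound (ex z F)      = suc z + nameBound F
  nameBound (call z F)    = suc z + nameBound F
  nameBound (cex z F)     = suc z + nameBound F

  nameBoundL : List Formula → ℕ
  nameBoundL []       = 0
  nameBoundL (F ∷ Fs) = nameBound F + nameBoundL Fs

+-≤-split : ∀ m {n o} → m + n ≤ o → m ≤ o × n ≤ o
+-≤-split m le = m+n≤o⇒m≤o m le , m+n≤o⇒n≤o m le

+₃-≤-split : ∀ l m {n o} → l + (m + n) ≤ o → l ≤ o × m ≤ o × n ≤ o
+₃-≤-split l m le = let (l≤ , mn≤) = +-≤-split l le in l≤ , +-≤-split m mn≤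

occT-fresh : ∀ t {y} → termBound t ≤ y → occT y t ≡ false
occT-fresh (var x) x<y = ≢⇒≡ᵇ-false (<⇒≢ x<y)
occT-fresh (con k) _   = refl

occTs-fresh : ∀ ts {y} → termsBound ts ≤ y → occTs y ts ≡ false
occTs-fresh []       _  = refl
occTs-fresh (t ∷ ts) le = let (t≤ , ts≤) = +-≤-split (termBound t) le in
  cong₂ _∨_ (occT-fresh t t≤) (occTs-fresh ts ts≤)

mutual
  occurs-fresh : ∀ F {y} → nameBound F ≤ y → occurs y F ≡ false
  occurs-fresh (atom p ts)   le = occTs-fresh ts le
  occurs-fresh top           _  = refl
  occurs-fresh bot           _  = refl
  occurs-fresh (neg F)       le = occurs-fresh F le
  occurs-fresh (and F G Hs)  le = occurs₃-fresh F G Hs le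
  occurs-fresh (or F G Hs)   le = occurs₃-fresh F G Hs le
  occurs-fresh (imp F G)     le = let (F≤ , G≤) = +-≤-split (nameBound F) le in
    cong₂ _∨_ (occurs-fresh F F≤) (occurs-fresh G G≤)
  occurs-fresh (cand F G Hs) le = occurs₃-fresh F G Hs le
  occurs-fresh (cor F G Hs)  le = occurs₃-fresh F G Hs le
  occurs-fresh (all z F)     le = binder-fresh z F le
  occurs-fresh (ex z F)      le = binder-fresh z F le
  occurs-fresh (call z F)    le = binder-fresh z F le
  occurs-fresh (cex z F)     le = binder-fresh z F le

  occurs₃-fresh : ∀ F G Hs {y} → nameBound F + (nameBound G + nameBoundL Hs) ≤ y →
                  (occurs y F ∨ occurs y G ∨ occursL y Hs) ≡ false
  occurs₃-fresh F G Hs le = let (F≤ , G≤ , Hs≤) = +₃-≤-split (nameBound F) (nameBound G) le in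
    cong₂ _∨_ (occurs-fresh F F≤) (cong₂ _∨_ (occurs-fresh G G≤) (occursL-fresh Hs Hs≤))

  binder-fresh : ∀ z F {y} → suc z + nameBound F ≤ y → ((z ≡ᵇ y) ∨ occurs y F) ≡ false
  binder-fresh z F le = let (z<y , F≤) = +-≤-split (suc z) le in
    cong₂ _∨_ (≢⇒≡ᵇ-false (<⇒≢ z<y)) (occurs-fresh F F≤)

  occursL-fresh : ∀ Fs {y} → nameBoundL Fs ≤ y → occursL y Fs ≡ false
  occursL-fresh []       _  = refl
  occursL-fresh (F ∷ Fs) le = let (F≤ , Fs≤) = +-≤-split (nameBound F) le in
    cong₂ _∨_ (occurs-fresh F F≤) (occursL-fresh Fs Fs≤)

record Renaming : Set where
  field
    onVar onCon      : ℕ → ℕ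
    onVar-involutive : ∀ n → onVar (onVar n) ≡ n
    onCon-involutive : ∀ n → onCon (onCon n) ≡ n

module Rename (r : Renaming) where
  open Renaming r

  ≡ᵇ-onVar : ∀ a b → (onVar a ≡ᵇ onVar b) ≡ (a ≡ᵇ b)
  ≡ᵇ-onVar = ≡ᵇ-injective λ {a} {b} e →
    trans (sym (onVar-involutive a)) (trans (cong onVar e) (onVar-involutive b))

  renT : Term → Term
  renT (var x) = var (onVar x)
  renT (con k) = con (onCon k)

  renTs : List Term → List Term
  renTs []       = []
  renTs (t ∷ ts) = renT t ∷ renTs ts

  mutual
    ren : Formula → Formula
    ren (atom p ts)   = atom p (renTs ts)
    ren top           = top
    ren bot           = bot
    ren (neg F)       = neg (ren F)
    ren (and F G Hs)  = and (ren F) (ren G) (renL Hs)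
    ren (or F G Hs)   = or (ren F) (ren G) (renL Hs)
    ren (imp F G)     = imp (ren F) (ren G)
    ren (cand F G Hs) = cand (ren F) (ren G) (renL Hs)
    ren (cor F G Hs)  = cor (ren F) (ren G) (renL Hs)
    ren (all z F)     = all (onVar z) (ren F)
    ren (ex z F)      = ex (onVar z) (ren F)
    ren (call z F)    = call (onVar z) (ren F)
    ren (cex z F)     = cex (onVar z) (ren F)

    renL : List Formula → List Formula
    renL []       = []
    renL (F ∷ Fs) = ren F ∷ renL Fs

  renC : Ctx → Ctx
  renC hole               = hole
  renC (negC c)           = negC (renC c)
  renC (and₀ c G Hs)      = and₀ (renC c) (ren G) (renL Hs)
  renC (and₁ F c Hs)      = and₁ (ren F) (renC c) (renL Hs)
  renC (andR F G ls c rs) = andR (ren F) (ren G) (renL ls) (renC c) (renL rs)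
  renC (or₀ c G Hs)       = or₀ (renC c) (ren G) (renL Hs)
  renC (or₁ F c Hs)       = or₁ (ren F) (renC c) (renL Hs)
  renC (orR F G ls c rs)  = orR (ren F) (ren G) (renL ls) (renC c) (renL rs)
  renC (impL c G)         = impL (renC c) (ren G)
  renC (impR F c)         = impR (ren F) (renC c)
  renC (allC z c)         = allC (onVar z) (renC c)
  renC (exC z c)          = exC (onVar z) (renC c)

  renT-involutive : ∀ t → renT (renT t) ≡ t
  renT-involutive (var x) = cong var (onVar-involutive x)
  renT-involutive (con k) = cong con (onCon-involutive k)

  renTs-involutive : ∀ ts → renTs (renTs ts) ≡ ts
  renTs-involutive []       = refl
  renTs-involutive (t ∷ ts) = cong₂ _∷_ (renT-involutive t) (renTs-involutive ts)

  mutual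
    ren-involutive : ∀ F → ren (ren F) ≡ F
    ren-involutive (atom p ts)   = cong (atom p) (renTs-involutive ts)
    ren-involutive top           = refl
    ren-involutive bot           = refl
    ren-involutive (neg F)       = cong neg (ren-involutive F)
    ren-involutive (and F G Hs)  = cong₃ and (ren-involutive F) (ren-involutive G) (renL-involutive Hs)
    ren-involutive (or F G Hs)   = cong₃ or (ren-involutive F) (ren-involutive G) (renL-involutive Hs)
    ren-involutive (imp F G)     = cong₂ imp (ren-involutive F) (ren-involutive G)
    ren-involutive (cand F G Hs) = cong₃ cand (ren-involutive F) (ren-involutive G) (renL-involutive Hs)
    ren-involutive (cor F G Hs)  = cong₃ cor (ren-involutive F) (ren-involutive G) (renL-involutive Hs)
    ren-involutive (all z F)     = cong₂ all (onVar-involutive z) (ren-involutive F)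
    ren-involutive (ex z F)      = cong₂ ex (onVar-involutive z) (ren-involutive F)
    ren-involutive (call z F)    = cong₂ call (onVar-involutive z) (ren-involutive F)
    ren-involutive (cex z F)     = cong₂ cex (onVar-involutive z) (ren-involutive F)

    renL-involutive : ∀ Fs → renL (renL Fs) ≡ Fs
    renL-involutive []       = refl
    renL-involutive (F ∷ Fs) = cong₂ _∷_ (ren-involutive F) (renL-involutive Fs)

  renC-involutive : ∀ c → renC (renC c) ≡ c
  renC-involutive hole               = refl
  renC-involutive (negC c)           = cong negC (renC-involutive c)
  renC-involutive (and₀ c G Hs)      = cong₃ and₀ (renC-involutive c) (ren-involutive G) (renL-involutive Hs)
  renC-involutive (and₁ F c Hs)      = cong₃ and₁ (ren-involutive F) (renC-involutive c) (renL-involutive Hs)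
  renC-involutive (andR F G ls c rs)
    rewrite ren-involutive F | ren-involutive G | renL-involutive ls
          | renC-involutive c | renL-involutive rs = refl
  renC-involutive (or₀ c G Hs)       = cong₃ or₀ (renC-involutive c) (ren-involutive G) (renL-involutive Hs)
  renC-involutive (or₁ F c Hs)       = cong₃ or₁ (ren-involutive F) (renC-involutive c) (renL-involutive Hs)
  renC-involutive (orR F G ls c rs)
    rewrite ren-involutive F | ren-involutive G | renL-involutive ls
          | renC-involutive c | renL-involutive rs = refl
  renC-involutive (impL c G)         = cong₂ impL (renC-involutive c) (ren-involutive G)
  renC-involutive (impR F c)         = cong₂ impR (ren-involutive F) (renC-involutive c)
  renC-involutive (allC z c)         = cong₂ allC (onVar-involutive z) (renC-involutive c)
  renC-involutive (exC z c)          = cong₂ exC (onVar-involutive z) (renC-involutive c)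

  renL-++ : ∀ xs ys → renL (xs ++ ys) ≡ renL xs ++ renL ys
  renL-++ []       ys = refl
  renL-++ (x ∷ xs) ys = cong (ren x ∷_) (renL-++ xs ys)

  ∈-renL : ∀ {G Gs} → G ∈ Gs → ren G ∈ renL Gs
  ∈-renL (here refl) = here refl
  ∈-renL (there m)   = there (∈-renL m)

  ren-plug : ∀ c X → ren (plug c X) ≡ plug (renC c) (ren X)
  ren-plug hole X               = refl
  ren-plug (negC c) X           = cong neg (ren-plug c X)
  ren-plug (and₀ c G Hs) X      = cong (λ Y → and Y (ren G) (renL Hs)) (ren-plug c X)
  ren-plug (and₁ F c Hs) X      = cong (λ Y → and (ren F) Y (renL Hs)) (ren-plug c X)
  ren-plug (andR F G ls c rs) X rewrite renL-++ ls (plug c X ∷ rs) | ren-plug c X = refl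
  ren-plug (or₀ c G Hs) X       = cong (λ Y → or Y (ren G) (renL Hs)) (ren-plug c X)
  ren-plug (or₁ F c Hs) X       = cong (λ Y → or (ren F) Y (renL Hs)) (ren-plug c X)
  ren-plug (orR F G ls c rs) X  rewrite renL-++ ls (plug c X ∷ rs) | ren-plug c X = refl
  ren-plug (impL c G) X         = cong (λ Y → imp Y (ren G)) (ren-plug c X)
  ren-plug (impR F c) X         = cong (imp (ren F)) (ren-plug c X)
  ren-plug (allC z c) X         = cong (all (onVar z)) (ren-plug c X)
  ren-plug (exC z c) X          = cong (ex (onVar z)) (ren-plug c X)

  positive-renC : ∀ c → positive (renC c) ≡ positive c
  positive-renC hole             = refl
  positive-renC (negC c)         = cong not (positive-renC c)
  positive-renC (and₀ c _ _)     = positive-renC c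
  positive-renC (and₁ _ c _)     = positive-renC c
  positive-renC (andR _ _ _ c _) = positive-renC c
  positive-renC (or₀ c _ _)      = positive-renC c
  positive-renC (or₁ _ c _)      = positive-renC c
  positive-renC (orR _ _ _ c _)  = positive-renC c
  positive-renC (impL c _)       = cong not (positive-renC c)
  positive-renC (impR _ c)       = positive-renC c
  positive-renC (allC _ c)       = positive-renC c
  positive-renC (exC _ c)        = positive-renC c

  ctxBinds-renC : ∀ t c → ctxBinds (onVar t) (renC c) ≡ ctxBinds t c
  ctxBinds-renC t hole             = refl
  ctxBinds-renC t (negC c)         = ctxBinds-renC t c
  ctxBinds-renC t (and₀ c _ _)     = ctxBinds-renC t c
  ctxBinds-renC t (and₁ _ c _)     = ctxBinds-renC t c
  ctxBinds-renC t (andR _ _ _ c _) = ctxBinds-renC t c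
  ctxBinds-renC t (or₀ c _ _)      = ctxBinds-renC t c
  ctxBinds-renC t (or₁ _ c _)      = ctxBinds-renC t c
  ctxBinds-renC t (orR _ _ _ c _)  = ctxBinds-renC t c
  ctxBinds-renC t (impL c _)       = ctxBinds-renC t c
  ctxBinds-renC t (impR _ c)       = ctxBinds-renC t c
  ctxBinds-renC t (allC z c)       = cong₂ _∨_ (≡ᵇ-onVar z t) (ctxBinds-renC t c)
  ctxBinds-renC t (exC z c)        = cong₂ _∨_ (≡ᵇ-onVar z t) (ctxBinds-renC t c)

  occTs-ren : ∀ y ts → occTs (onVar y) (renTs ts) ≡ occTs y ts
  occTs-ren y []             = refl
  occTs-ren y (var z ∷ ts)   = cong₂ _∨_ (≡ᵇ-onVar z y) (occTs-ren y ts)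
  occTs-ren y (con _ ∷ ts)   = occTs-ren y ts

  mutual
    occurs-ren : ∀ y F → occurs (onVar y) (ren F) ≡ occurs y F
    occurs-ren y (atom p ts)   = occTs-ren y ts
    occurs-ren y top           = refl
    occurs-ren y bot           = refl
    occurs-ren y (neg F)       = occurs-ren y F
    occurs-ren y (and F G Hs) =
      cong₃ (λ a b c → a ∨ b ∨ c) (occurs-ren y F) (occurs-ren y G) (occursL-ren y Hs)
    occurs-ren y (or F G Hs) =
      cong₃ (λ a b c → a ∨ b ∨ c) (occurs-ren y F) (occurs-ren y G) (occursL-ren y Hs)
    occurs-ren y (imp F G)     = cong₂ _∨_ (occurs-ren y F) (occurs-ren y G)
    occurs-ren y (cand F G Hs) =
      cong₃ (λ a b c → a ∨ b ∨ c) (occurs-ren y F) (occurs-ren y G) (occursL-ren y Hs)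
    occurs-ren y (cor F G Hs) =
      cong₃ (λ a b c → a ∨ b ∨ c) (occurs-ren y F) (occurs-ren y G) (occursL-ren y Hs)
    occurs-ren y (all z F)     = cong₂ _∨_ (≡ᵇ-onVar z y) (occurs-ren y F)
    occurs-ren y (ex z F)      = cong₂ _∨_ (≡ᵇ-onVar z y) (occurs-ren y F)
    occurs-ren y (call z F)    = cong₂ _∨_ (≡ᵇ-onVar z y) (occurs-ren y F)
    occurs-ren y (cex z F)     = cong₂ _∨_ (≡ᵇ-onVar z y) (occurs-ren y F)

    occursL-ren : ∀ y Fs → occursL (onVar y) (renL Fs) ≡ occursL y Fs
    occursL-ren y []       = refl
    occursL-ren y (F ∷ Fs) = cong₂ _∨_ (occurs-ren y F) (occursL-ren y Fs)

  mutual
    freeIn-ren : ∀ y F → freeIn (onVar y) (ren F) ≡ freeIn y F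
    freeIn-ren y (atom p ts)   = occTs-ren y ts
    freeIn-ren y top           = refl
    freeIn-ren y bot           = refl
    freeIn-ren y (neg F)       = freeIn-ren y F
    freeIn-ren y (and F G Hs) =
      cong₃ (λ a b c → a ∨ b ∨ c) (freeIn-ren y F) (freeIn-ren y G) (freeInL-ren y Hs)
    freeIn-ren y (or F G Hs) =
      cong₃ (λ a b c → a ∨ b ∨ c) (freeIn-ren y F) (freeIn-ren y G) (freeInL-ren y Hs)
    freeIn-ren y (imp F G)     = cong₂ _∨_ (freeIn-ren y F) (freeIn-ren y G)
    freeIn-ren y (cand F G Hs) =
      cong₃ (λ a b c → a ∨ b ∨ c) (freeIn-ren y F) (freeIn-ren y G) (freeInL-ren y Hs)
    freeIn-ren y (cor F G Hs) =
      cong₃ (λ a b c → a ∨ b ∨ c) (freeIn-ren y F) (freeIn-ren y G) (freeInL-ren y Hs)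
    freeIn-ren y (all z F)     = cong₂ (λ b B → if b then false else B) (≡ᵇ-onVar z y) (freeIn-ren y F)
    freeIn-ren y (ex z F)      = cong₂ (λ b B → if b then false else B) (≡ᵇ-onVar z y) (freeIn-ren y F)
    freeIn-ren y (call z F)    = cong₂ (λ b B → if b then false else B) (≡ᵇ-onVar z y) (freeIn-ren y F)
    freeIn-ren y (cex z F)     = cong₂ (λ b B → if b then false else B) (≡ᵇ-onVar z y) (freeIn-ren y F)

    freeInL-ren : ∀ y Fs → freeInL (onVar y) (renL Fs) ≡ freeInL y Fs
    freeInL-ren y []       = refl
    freeInL-ren y (F ∷ Fs) = cong₂ _∨_ (freeIn-ren y F) (freeInL-ren y Fs)

  mutual
    freeUnder-ren : ∀ t x F → freeUnder (onVar t) (onVar x) (ren F) ≡ freeUnder t x F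
    freeUnder-ren t x (atom p ts)   = refl
    freeUnder-ren t x top           = refl
    freeUnder-ren t x bot           = refl
    freeUnder-ren t x (neg F)       = freeUnder-ren t x F
    freeUnder-ren t x (and F G Hs) =
      cong₃ (λ a b c → a ∨ b ∨ c) (freeUnder-ren t x F) (freeUnder-ren t x G) (freeUnderL-ren t x Hs)
    freeUnder-ren t x (or F G Hs) =
      cong₃ (λ a b c → a ∨ b ∨ c) (freeUnder-ren t x F) (freeUnder-ren t x G) (freeUnderL-ren t x Hs)
    freeUnder-ren t x (imp F G)     = cong₂ _∨_ (freeUnder-ren t x F) (freeUnder-ren t x G)
    freeUnder-ren t x (cand F G Hs) =
      cong₃ (λ a b c → a ∨ b ∨ c) (freeUnder-ren t x F) (freeUnder-ren t x G) (freeUnderL-ren t x Hs)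
    freeUnder-ren t x (cor F G Hs) =
      cong₃ (λ a b c → a ∨ b ∨ c) (freeUnder-ren t x F) (freeUnder-ren t x G) (freeUnderL-ren t x Hs)
    freeUnder-ren t x (all z F)     = binder-ren t x z F
    freeUnder-ren t x (ex z F)      = binder-ren t x z F
    freeUnder-ren t x (call z F)    = binder-ren t x z F
    freeUnder-ren t x (cex z F)     = binder-ren t x z F

    binder-ren : ∀ t x z F → binder (onVar t) (onVar x) (onVar z) (ren F) ≡ binder t x z F
    binder-ren t x z F
      rewrite ≡ᵇ-onVar z x | ≡ᵇ-onVar z t | freeIn-ren x F | freeUnder-ren t x F = refl

    freeUnderL-ren : ∀ t x Fs → freeUnderL (onVar t) (onVar x) (renL Fs) ≡ freeUnderL t x Fs
    freeUnderL-ren t x []       = refl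
    freeUnderL-ren t x (F ∷ Fs) = cong₂ _∨_ (freeUnder-ren t x F) (freeUnderL-ren t x Fs)

  substT-ren : ∀ x t s → renT (substT x t s) ≡ substT (onVar x) (renT t) (renT s)
  substT-ren x t (con k) = refl
  substT-ren x t (var z) rewrite ≡ᵇ-onVar z x with z ≡ᵇ x
  ... | true  = refl
  ... | false = refl

  substTs-ren : ∀ x t ss → renTs (substTs x t ss) ≡ substTs (onVar x) (renT t) (renTs ss)
  substTs-ren x t []       = refl
  substTs-ren x t (s ∷ ss) = cong₂ _∷_ (substT-ren x t s) (substTs-ren x t ss)

  mutual
    ren-subst : ∀ x t F → ren (subst x t F) ≡ subst (onVar x) (renT t) (ren F)
    ren-subst x t (atom p ts)   = cong (atom p) (substTs-ren x t ts)
    ren-subst x t top           = refl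
    ren-subst x t bot           = refl
    ren-subst x t (neg F)       = cong neg (ren-subst x t F)
    ren-subst x t (and F G Hs)  = cong₃ and (ren-subst x t F) (ren-subst x t G) (renL-substs x t Hs)
    ren-subst x t (or F G Hs)   = cong₃ or (ren-subst x t F) (ren-subst x t G) (renL-substs x t Hs)
    ren-subst x t (imp F G)     = cong₂ imp (ren-subst x t F) (ren-subst x t G)
    ren-subst x t (cand F G Hs) = cong₃ cand (ren-subst x t F) (ren-subst x t G) (renL-substs x t Hs)
    ren-subst x t (cor F G Hs)  = cong₃ cor (ren-subst x t F) (ren-subst x t G) (renL-substs x t Hs)
    ren-subst x t (all z F) rewrite ≡ᵇ-onVar z x with z ≡ᵇ x
    ... | true  = refl
    ... | false = cong (all (onVar z)) (ren-subst x t F)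
    ren-subst x t (ex z F) rewrite ≡ᵇ-onVar z x with z ≡ᵇ x
    ... | true  = refl
    ... | false = cong (ex (onVar z)) (ren-subst x t F)
    ren-subst x t (call z F) rewrite ≡ᵇ-onVar z x with z ≡ᵇ x
    ... | true  = refl
    ... | false = cong (call (onVar z)) (ren-subst x t F)
    ren-subst x t (cex z F) rewrite ≡ᵇ-onVar z x with z ≡ᵇ x
    ... | true  = refl
    ... | false = cong (cex (onVar z)) (ren-subst x t F)

    renL-substs : ∀ x t Fs → renL (substs x t Fs) ≡ substs (onVar x) (renT t) (renL Fs)
    renL-substs x t []       = refl
    renL-substs x t (F ∷ Fs) = cong₂ _∷_ (ren-subst x t F) (renL-substs x t Fs)

  B2ok-ren : ∀ c x G t → B2ok c x G t → B2ok (renC c) (onVar x) (ren G) (renT t)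
  B2ok-ren c x G (con k) ok = ok
  B2ok-ren c x G (var v) ok rewrite ctxBinds-renC v c | freeUnder-ren v x G = ok

  mutual
    renCF : CFormula → CFormula
    renCF (atom p ts)  = atom p (renTs ts)
    renCF top          = top
    renCF bot          = bot
    renCF (neg φ)      = neg (renCF φ)
    renCF (and φ ψ χs) = and (renCF φ) (renCF ψ) (renCFL χs)
    renCF (or φ ψ χs)  = or (renCF φ) (renCF ψ) (renCFL χs)
    renCF (imp φ ψ)    = imp (renCF φ) (renCF ψ)
    renCF (all z φ)    = all (onVar z) (renCF φ)
    renCF (ex z φ)     = ex (onVar z) (renCF φ)

    renCFL : List CFormula → List CFormula
    renCFL []       = []
    renCFL (φ ∷ φs) = renCF φ ∷ renCFL φs

  mutual
    elem-ren : ∀ F → elem (ren F) ≡ renCF (elem F)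
    elem-ren (atom p ts)   = refl
    elem-ren top           = refl
    elem-ren bot           = refl
    elem-ren (neg F)       = cong neg (elem-ren F)
    elem-ren (and F G Hs)  = cong₃ and (elem-ren F) (elem-ren G) (elemL-ren Hs)
    elem-ren (or F G Hs)   = cong₃ or (elem-ren F) (elem-ren G) (elemL-ren Hs)
    elem-ren (imp F G)     = cong₂ imp (elem-ren F) (elem-ren G)
    elem-ren (cand F G Hs) = refl
    elem-ren (cor F G Hs)  = refl
    elem-ren (all z F)     = cong (all (onVar z)) (elem-ren F)
    elem-ren (ex z F)      = cong (ex (onVar z)) (elem-ren F)
    elem-ren (call z F)    = refl
    elem-ren (cex z F)     = refl

    elemL-ren : ∀ Fs → elemL (renL Fs) ≡ renCFL (elemL Fs)
    elemL-ren []       = refl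
    elemL-ren (F ∷ Fs) = cong₂ _∷_ (elem-ren F) (elemL-ren Fs)

  -- Renaming the constants of a formula is undone by reinterpreting them.
  renStructure : Structure → Structure
  renStructure M = record M { const = Structure.const M ∘ onCon }

  module _ (M : Structure) where

    -- Stated for an arbitrary P because the two vectors have the lengths length (renTs ts)
    -- and length ts, which are equal only propositionally.
    pred-evalTs-ren : ∀ (P : (n : ℕ) → Vec (Structure.D M) n → Set) {ρ σ} →
                      (∀ z → ρ (onVar z) ≡ σ z) →
                      ∀ ts → P _ (evalTs M ρ (renTs ts)) ≡ P _ (evalTs (renStructure M) σ ts)
    pred-evalTs-ren P ρσ []           = refl
    pred-evalTs-ren P ρσ (var x ∷ ts) =
      trans (pred-evalTs-ren (λ n v → P (suc n) (_ ∷ v)) ρσ ts) (cong (λ d → P _ (d ∷ _)) (ρσ x))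
    pred-evalTs-ren P ρσ (con k ∷ ts) = pred-evalTs-ren (λ n v → P (suc n) (_ ∷ v)) ρσ ts

    update-ren : ∀ {ρ σ} → (∀ z → ρ (onVar z) ≡ σ z) →
                 ∀ x d z → update M ρ (onVar x) d (onVar z) ≡ update (renStructure M) σ x d z
    update-ren ρσ x d z rewrite ≡ᵇ-onVar z x with z ≡ᵇ x
    ... | true  = refl
    ... | false = ρσ z

    -- σ agrees with ρ ∘ onVar only pointwise: that is all that survives an update under a quantifier.
    mutual
      Tr-ren : ∀ {ρ σ} → (∀ z → ρ (onVar z) ≡ σ z) →
               ∀ φ → Tr M ρ (renCF φ) ⇔ Tr (renStructure M) σ φ
      Tr-ren ρσ (atom p ts) = ≡⇒⇔ (pred-evalTs-ren (λ n v → ¬ ¬ Structure.pred M p n v) ρσ ts)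
      Tr-ren ρσ top          = mk⇔ id id
      Tr-ren ρσ bot          = mk⇔ id id
      Tr-ren ρσ (neg φ)      = ¬-cong-⇔ (Tr-ren ρσ φ)
      Tr-ren ρσ (and φ ψ χs) = Tr-ren ρσ φ ×-⇔ Tr-ren ρσ ψ ×-⇔ TrAll-ren ρσ χs
      Tr-ren ρσ (or φ ψ χs)  =
        ¬-cong-⇔ (¬-cong-⇔ (Tr-ren ρσ φ) ×-⇔ ¬-cong-⇔ (Tr-ren ρσ ψ) ×-⇔ NoneTr-ren ρσ χs)
      Tr-ren ρσ (imp φ ψ)    = →-cong-⇔ (Tr-ren ρσ φ) (Tr-ren ρσ ψ)
      Tr-ren {ρ} {σ} ρσ (all x φ) = Π-cong-⇔ λ d → Tr-ren (update-ren {ρ} {σ} ρσ x d) φ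
      Tr-ren {ρ} {σ} ρσ (ex x φ)  =
        ¬-cong-⇔ (Π-cong-⇔ λ d → ¬-cong-⇔ (Tr-ren (update-ren {ρ} {σ} ρσ x d) φ))

      TrAll-ren : ∀ {ρ σ} → (∀ z → ρ (onVar z) ≡ σ z) →
                  ∀ φs → TrAll M ρ (renCFL φs) ⇔ TrAll (renStructure M) σ φs
      TrAll-ren ρσ []       = mk⇔ id id
      TrAll-ren ρσ (φ ∷ φs) = Tr-ren ρσ φ ×-⇔ TrAll-ren ρσ φs

      NoneTr-ren : ∀ {ρ σ} → (∀ z → ρ (onVar z) ≡ σ z) →
                   ∀ φs → NoneTr M ρ (renCFL φs) ⇔ NoneTr (renStructure M) σ φs
      NoneTr-ren ρσ []       = mk⇔ id id
      NoneTr-ren ρσ (φ ∷ φs) = ¬-cong-⇔ (Tr-ren ρσ φ) ×-⇔ NoneTr-ren ρσ φs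

  Stable-ren : ∀ {F} → Stable F → Stable (ren F)
  Stable-ren {F} st M ρ rewrite elem-ren F =
    from (Tr-ren M (λ _ → refl) (elem F)) (st (renStructure M) (ρ ∘ onVar))

  plug-ren⁻¹ : ∀ {F} c Y → plug c Y ≡ ren F → plug (renC c) (ren Y) ≡ F
  plug-ren⁻¹ {F} c Y e = trans (sym (ren-plug c Y)) (trans (cong ren e) (ren-involutive F))

  ren-plug-ren : ∀ c Y → ren (plug (renC c) (ren Y)) ≡ plug c Y
  ren-plug-ren c Y = trans (ren-plug (renC c) (ren Y)) (cong₂ plug (renC-involutive c) (ren-involutive Y))

  ren-plug-subst : ∀ c x t G →
                   ren (plug c (subst x t G)) ≡ plug (renC c) (subst (onVar x) (renT t) (ren G))
  ren-plug-subst c x t G = trans (ren-plug c (subst x t G)) (cong (plug (renC c)) (ren-subst x t G))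

  ren-plug-instance : ∀ c x G y →
    ren (plug (renC c) (subst (onVar x) (var y) (ren G))) ≡ plug c (subst x (var (onVar y)) G)
  ren-plug-instance c x G y =
    trans (ren-plug-subst (renC c) (onVar x) (var y) (ren G))
          (cong₃ (λ c′ x′ G′ → plug c′ (subst x′ (var (onVar y)) G′))
                 (renC-involutive c) (onVar-involutive x) (ren-involutive G))

  ⊢-ren : ∀ {F} → CL2⊢ F → CL2⊢ ren F
  ⊢-ren {F} (ruleA st a⊓ a⊔ a⊓ˣ a⊔ˣ) = ruleA′ (Stable-ren st) premises
    where
    premises : RuleA-premises (ren F)
    premises c (alts ⊓ G₁ G₂ Gs) e pos G m = transport CL2⊢_ (ren-plug-ren c G)
      (⊢-ren (a⊓ (renC c) _ _ _ (plug-ren⁻¹ c _ e) (trans (positive-renC c) pos) (ren G) (∈-renL m)))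
    premises c (alts ⊔ G₁ G₂ Gs) e pos G m = transport CL2⊢_ (ren-plug-ren c G)
      (⊢-ren (a⊔ (renC c) _ _ _ (plug-ren⁻¹ c _ e) (trans (positive-renC c) pos) (ren G) (∈-renL m)))
    premises c (quant ⊓ x G) e pos
      with a⊓ˣ (renC c) (onVar x) (ren G) (plug-ren⁻¹ c _ e) (trans (positive-renC c) pos)
    ... | y , y∉ , d =
      onVar y , trans (occurs-ren y F) y∉ , transport CL2⊢_ (ren-plug-instance c x G y) (⊢-ren d)
    premises c (quant ⊔ x G) e pos
      with a⊔ˣ (renC c) (onVar x) (ren G) (plug-ren⁻¹ c _ e) (trans (positive-renC c) pos)
    ... | y , y∉ , d =
      onVar y , trans (occurs-ren y F) y∉ , transport CL2⊢_ (ren-plug-instance c x G y) (⊢-ren d)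
  ⊢-ren (ruleB1⊓ c G₁ G₂ Gs G pos m d) = transport CL2⊢_ (sym (ren-plug c _))
    (ruleB1⊓ (renC c) _ _ _ (ren G) (trans (positive-renC c) pos) (∈-renL m)
             (transport CL2⊢_ (ren-plug c G) (⊢-ren d)))
  ⊢-ren (ruleB1⊔ c G₁ G₂ Gs G pos m d) = transport CL2⊢_ (sym (ren-plug c _))
    (ruleB1⊔ (renC c) _ _ _ (ren G) (trans (positive-renC c) pos) (∈-renL m)
             (transport CL2⊢_ (ren-plug c G) (⊢-ren d)))
  ⊢-ren (ruleB2⊓ c x G t pos ok d) = transport CL2⊢_ (sym (ren-plug c _))
    (ruleB2⊓ (renC c) (onVar x) (ren G) (renT t) (trans (positive-renC c) pos) (B2ok-ren c x G t ok)
             (transport CL2⊢_ (ren-plug-subst c x t G) (⊢-ren d)))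
  ⊢-ren (ruleB2⊔ c x G t pos ok d) = transport CL2⊢_ (sym (ren-plug c _))
    (ruleB2⊔ (renC c) (onVar x) (ren G) (renT t) (trans (positive-renC c) pos) (B2ok-ren c x G t ok)
             (transport CL2⊢_ (ren-plug-subst c x t G) (⊢-ren d)))

  renL-fixed-++ : ∀ ls Y rs → renL (ls ++ Y ∷ rs) ≡ ls ++ Y ∷ rs →
                  renL ls ≡ ls × ren Y ≡ Y × renL rs ≡ rs
  renL-fixed-++ []       Y rs e = let (eY , ers) = List.∷-injective e in refl , eY , ers
  renL-fixed-++ (l ∷ ls) Y rs e =
    let (el , els) = List.∷-injective e
        (els′ , eY , ers) = renL-fixed-++ ls Y rs els
    in cong₂ _∷_ el els′ , eY , ers

  ren-fixed-plug : ∀ c X → ren (plug c X) ≡ plug c X → renC c ≡ c × ren X ≡ X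
  ren-fixed-plug hole X e = refl , e
  ren-fixed-plug (negC c) X e =
    let (ec , eX) = ren-fixed-plug c X (neg-injective e) in cong negC ec , eX
  ren-fixed-plug (and₀ c G Hs) X e =
    let (e₁ , e₂ , e₃) = and-injective e ; (ec , eX) = ren-fixed-plug c X e₁
    in cong₃ and₀ ec e₂ e₃ , eX
  ren-fixed-plug (and₁ F c Hs) X e =
    let (e₁ , e₂ , e₃) = and-injective e ; (ec , eX) = ren-fixed-plug c X e₂
    in cong₃ and₁ e₁ ec e₃ , eX
  ren-fixed-plug (andR F G ls c rs) X e =
    let (e₁ , e₂ , e₃) = and-injective e
        (els , eY , ers) = renL-fixed-++ ls (plug c X) rs e₃
        (ec , eX) = ren-fixed-plug c X eY
    in cong₅ andR e₁ e₂ els ec ers , eX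
  ren-fixed-plug (or₀ c G Hs) X e =
    let (e₁ , e₂ , e₃) = or-injective e ; (ec , eX) = ren-fixed-plug c X e₁
    in cong₃ or₀ ec e₂ e₃ , eX
  ren-fixed-plug (or₁ F c Hs) X e =
    let (e₁ , e₂ , e₃) = or-injective e ; (ec , eX) = ren-fixed-plug c X e₂
    in cong₃ or₁ e₁ ec e₃ , eX
  ren-fixed-plug (orR F G ls c rs) X e =
    let (e₁ , e₂ , e₃) = or-injective e
        (els , eY , ers) = renL-fixed-++ ls (plug c X) rs e₃
        (ec , eX) = ren-fixed-plug c X eY
    in cong₅ orR e₁ e₂ els ec ers , eX
  ren-fixed-plug (impL c G) X e =
    let (e₁ , e₂) = imp-injective e ; (ec , eX) = ren-fixed-plug c X e₁
    in cong₂ impL ec e₂ , eX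
  ren-fixed-plug (impR F c) X e =
    let (e₁ , e₂) = imp-injective e ; (ec , eX) = ren-fixed-plug c X e₂
    in cong₂ impR e₁ ec , eX
  ren-fixed-plug (allC z c) X e =
    let (e₁ , e₂) = all-injective e ; (ec , eX) = ren-fixed-plug c X e₂
    in cong₂ allC e₁ ec , eX
  ren-fixed-plug (exC z c) X e =
    let (e₁ , e₂) = ex-injective e ; (ec , eX) = ren-fixed-plug c X e₂
    in cong₂ exC e₁ ec , eX

  ren-fixed-quant : ∀ k c x G → ren (plug c ⌜ quant k x G ⌝) ≡ plug c ⌜ quant k x G ⌝ →
                    renC c ≡ c × onVar x ≡ x × ren G ≡ G
  ren-fixed-quant ⊓ c x G e = let (ec , eX) = ren-fixed-plug c (call x G) e in ec , call-injective eX
  ren-fixed-quant ⊔ c x G e = let (ec , eX) = ren-fixed-plug c (cex x G) e in ec , cex-injective eX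

  ⊢-instance-ren : ∀ {c x G t} → renC c ≡ c → onVar x ≡ x → ren G ≡ G →
                   CL2⊢ plug c (subst x t G) → CL2⊢ plug c (subst x (renT t) G)
  ⊢-instance-ren {c} {x} {G} {t} c-fixed x-fixed G-fixed d =
    transport CL2⊢_ (trans (ren-plug-subst c x t G)
                           (cong₃ (λ c′ x′ G′ → plug c′ (subst x′ (renT t) G′)) c-fixed x-fixed G-fixed))
              (⊢-ren d)

  B2ok-instance-ren : ∀ {c x G t} → renC c ≡ c → onVar x ≡ x → ren G ≡ G →
                      B2ok c x G t → B2ok c x G (renT t)
  B2ok-instance-ren {c} {x} {G} {t} c-fixed x-fixed G-fixed ok =
    transport id (cong₃ (λ c′ x′ G′ → B2ok c′ x′ G′ (renT t)) c-fixed x-fixed G-fixed)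
                 (B2ok-ren c x G t ok)

  -- Variables have to be fixed wherever they occur, because the fresh variable of Rule A may lie
  -- below nameBound F; constants are only ever swapped above it, so fixing those below suffices.
  VarsFixed : (ℕ → Bool) → Set
  VarsFixed occ = ∀ z → occ z ≡ true → onVar z ≡ z

  ConsFixedBelow : ℕ → Set
  ConsFixedBelow b = ∀ k → k < b → onCon k ≡ k

  VarsFixed-∨ˡ : ∀ {P Q : ℕ → Bool} → VarsFixed (λ z → P z ∨ Q z) → VarsFixed P
  VarsFixed-∨ˡ vs z h = vs z (∨-trueˡ _ h)

  VarsFixed-∨ʳ : ∀ (P : ℕ → Bool) {Q} → VarsFixed (λ z → P z ∨ Q z) → VarsFixed Q
  VarsFixed-∨ʳ P vs z h = vs z (∨-trueʳ (P z) h)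

  renT-fixed : ∀ t {b} → termBound t ≤ b → VarsFixed (λ z → occT z t) → ConsFixedBelow b → renT t ≡ t
  renT-fixed (var x) _   vs _  = cong var (vs x (≡ᵇ-refl x))
  renT-fixed (con k) k<b _  cs = cong con (cs k k<b)

  renTs-fixed : ∀ ts {b} → termsBound ts ≤ b → VarsFixed (λ z → occTs z ts) → ConsFixedBelow b →
                renTs ts ≡ ts
  renTs-fixed []       _  _  _  = refl
  renTs-fixed (t ∷ ts) le vs cs = let (t≤ , ts≤) = +-≤-split (termBound t) le in
    cong₂ _∷_ (renT-fixed t t≤ (VarsFixed-∨ˡ vs) cs)
              (renTs-fixed ts ts≤ (VarsFixed-∨ʳ (λ z → occT z t) vs) cs)

  mutual
    ren-fixed : ∀ F {b} → nameBound F ≤ b → VarsFixed (λ z → occurs z F) → ConsFixedBelow b → ren F ≡ F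
    ren-fixed (atom p ts)   le vs cs = cong (atom p) (renTs-fixed ts le vs cs)
    ren-fixed top           _  _  _  = refl
    ren-fixed bot           _  _  _  = refl
    ren-fixed (neg F)       le vs cs = cong neg (ren-fixed F le vs cs)
    ren-fixed (and F G Hs)  le vs cs = let (e₁ , e₂ , e₃) = ren₃-fixed F G Hs le vs cs in cong₃ and e₁ e₂ e₃
    ren-fixed (or F G Hs)   le vs cs = let (e₁ , e₂ , e₃) = ren₃-fixed F G Hs le vs cs in cong₃ or e₁ e₂ e₃
    ren-fixed (imp F G)     le vs cs = let (F≤ , G≤) = +-≤-split (nameBound F) le in
      cong₂ imp (ren-fixed F F≤ (VarsFixed-∨ˡ vs) cs)
                (ren-fixed G G≤ (VarsFixed-∨ʳ (λ z → occurs z F) vs) cs)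
    ren-fixed (cand F G Hs) le vs cs = let (e₁ , e₂ , e₃) = ren₃-fixed F G Hs le vs cs in cong₃ cand e₁ e₂ e₃
    ren-fixed (cor F G Hs)  le vs cs = let (e₁ , e₂ , e₃) = ren₃-fixed F G Hs le vs cs in cong₃ cor e₁ e₂ e₃
    ren-fixed (all z F)     le vs cs = let (z≡ , e) = binder-ren-fixed z F le vs cs in cong₂ all z≡ e
    ren-fixed (ex z F)      le vs cs = let (z≡ , e) = binder-ren-fixed z F le vs cs in cong₂ ex z≡ e
    ren-fixed (call z F)    le vs cs = let (z≡ , e) = binder-ren-fixed z F le vs cs in cong₂ call z≡ e
    ren-fixed (cex z F)     le vs cs = let (z≡ , e) = binder-ren-fixed z F le vs cs in cong₂ cex z≡ e

    ren₃-fixed : ∀ F G Hs {b} → nameBound F + (nameBound G + nameBoundL Hs) ≤ b →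
                 VarsFixed (λ z → occurs z F ∨ occurs z G ∨ occursL z Hs) → ConsFixedBelow b →
                 ren F ≡ F × ren G ≡ G × renL Hs ≡ Hs
    ren₃-fixed F G Hs le vs cs =
      let (F≤ , G≤ , Hs≤) = +₃-≤-split (nameBound F) (nameBound G) le
          vsGHs = VarsFixed-∨ʳ (λ z → occurs z F) vs
      in ren-fixed F F≤ (VarsFixed-∨ˡ vs) cs
       , ren-fixed G G≤ (VarsFixed-∨ˡ vsGHs) cs
       , renL-fixed Hs Hs≤ (VarsFixed-∨ʳ (λ z → occurs z G) vsGHs) cs

    binder-ren-fixed : ∀ z F {b} → suc z + nameBound F ≤ b →
                       VarsFixed (λ y → (z ≡ᵇ y) ∨ occurs y F) → ConsFixedBelow b →
                       onVar z ≡ z × ren F ≡ F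
    binder-ren-fixed z F le vs cs =
      vs z (∨-trueˡ _ (≡ᵇ-refl z)) , ren-fixed F (m+n≤o⇒n≤o (suc z) le) (VarsFixed-∨ʳ (z ≡ᵇ_) vs) cs

    renL-fixed : ∀ Fs {b} → nameBoundL Fs ≤ b → VarsFixed (λ z → occursL z Fs) → ConsFixedBelow b →
                 renL Fs ≡ Fs
    renL-fixed []       _  _  _  = refl
    renL-fixed (F ∷ Fs) le vs cs = let (F≤ , Fs≤) = +-≤-split (nameBound F) le in
      cong₂ _∷_ (ren-fixed F F≤ (VarsFixed-∨ˡ vs) cs)
                (renL-fixed Fs Fs≤ (VarsFixed-∨ʳ (λ z → occurs z F) vs) cs)

swap : ℕ → ℕ → ℕ → ℕ
swap a b z = if z ≡ᵇ a then b else (if z ≡ᵇ b then a else z)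

swap-involutive : ∀ a b z → swap a b (swap a b z) ≡ z
swap-involutive a b z with z ≡ᵇ a in z≡a
... | true with b ≡ᵇ a in b≡a
...   | true  = trans (≡ᵇ-true⇒≡ b≡a) (sym (≡ᵇ-true⇒≡ z≡a))
...   | false rewrite ≡ᵇ-refl b = sym (≡ᵇ-true⇒≡ z≡a)
swap-involutive a b z | false with z ≡ᵇ b in z≡b
...   | true  rewrite ≡ᵇ-refl a = sym (≡ᵇ-true⇒≡ z≡b)
...   | false rewrite z≡a | z≡b = refl

swap-left : ∀ a b → swap a b a ≡ b
swap-left a b rewrite ≡ᵇ-refl a = refl

swap-fixes : ∀ {a b z} → z ≢ a → z ≢ b → swap a b z ≡ z
swap-fixes z≢a z≢b rewrite ≢⇒≡ᵇ-false z≢a | ≢⇒≡ᵇ-false z≢b = refl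

swapVar : ℕ → ℕ → Renaming
swapVar a b = record { onVar = swap a b ; onCon = id
                     ; onVar-involutive = swap-involutive a b ; onCon-involutive = λ _ → refl }

swapCon : ℕ → ℕ → Renaming
swapCon a b = record { onVar = id ; onCon = swap a b
                     ; onVar-involutive = λ _ → refl ; onCon-involutive = swap-involutive a b }

absent≢present : ∀ {a b} F → occurs a F ≡ false → occurs b F ≡ true → b ≢ a
absent≢present F a∉ b∈ refl with trans (sym b∈) a∉
... | ()

swapVar-fixes : ∀ F {a b} → occurs a F ≡ false → occurs b F ≡ false →
                Rename.ren (swapVar a b) F ≡ F
swapVar-fixes F a∉ b∉ = Rename.ren-fixed (swapVar _ _) F ≤-refl
  (λ z z∈ → swap-fixes (absent≢present F a∉ z∈) (absent≢present F b∉ z∈)) (λ _ _ → refl)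

swapCon-fixes : ∀ F {a b} → nameBound F ≤ a → nameBound F ≤ b →
                Rename.ren (swapCon a b) F ≡ F
swapCon-fixes F F≤a F≤b = Rename.ren-fixed (swapCon _ _) F ≤-refl (λ _ _ → refl)
  (λ k k<F → swap-fixes (<⇒≢ (<-≤-trans k<F F≤a)) (<⇒≢ (<-≤-trans k<F F≤b)))

-- Finitely many witnesses suffice

⊢-fresh-var : ∀ c k x G {F y} → plug c ⌜ quant k x G ⌝ ≡ F → occurs y F ≡ false →
              CL2⊢ plug c (subst x (var y) G) → CL2⊢ plug c (subst x (var (nameBound F)) G)
⊢-fresh-var c k x G {F} {y} refl y∉ d =
  let r = swapVar y (nameBound F)
      (c-fixed , x-fixed , G-fixed) =
        Rename.ren-fixed-quant r k c x G (swapVar-fixes F y∉ (occurs-fresh F ≤-refl))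
  in transport (λ w → CL2⊢ plug c (subst x (var w) G)) (swap-left y _)
               (Rename.⊢-instance-ren r c-fixed x-fixed G-fixed d)

B2ok-fresh-var : ∀ c k x G {F y} → plug c ⌜ quant k x G ⌝ ≡ F → occurs y F ≡ false →
                 B2ok c x G (var y) → B2ok c x G (var (nameBound F))
B2ok-fresh-var c k x G {F} {y} refl y∉ ok =
  let r = swapVar y (nameBound F)
      (c-fixed , x-fixed , G-fixed) =
        Rename.ren-fixed-quant r k c x G (swapVar-fixes F y∉ (occurs-fresh F ≤-refl))
  in transport (λ w → B2ok c x G (var w)) (swap-left y _)
               (Rename.B2ok-instance-ren r c-fixed x-fixed G-fixed ok)

⊢-fresh-con : ∀ c k x G {F n} → plug c ⌜ quant k x G ⌝ ≡ F → nameBound F ≤ n →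
              CL2⊢ plug c (subst x (con n) G) → CL2⊢ plug c (subst x (con (nameBound F)) G)
⊢-fresh-con c k x G {F} {n} refl F≤n d =
  let r = swapCon n (nameBound F)
      (c-fixed , x-fixed , G-fixed) = Rename.ren-fixed-quant r k c x G (swapCon-fixes F F≤n ≤-refl)
  in transport (λ w → CL2⊢ plug c (subst x (con w) G)) (swap-left n _)
               (Rename.⊢-instance-ren r c-fixed x-fixed G-fixed d)

candidates : Formula → List Term
candidates F = map var (upTo (suc (nameBound F))) ++ map con (upTo (suc (nameBound F)))

some-instance-candidate : ∀ c k x G {F} → plug c ⌜ quant k x G ⌝ ≡ F → SomeInstance c x G →
                          Σ Term λ t → t ∈ candidates F × B2ok c x G t × CL2⊢ plug c (subst x t G)
some-instance-candidate c k x G {F} e (var v , ok , d) with v ≤? nameBound F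
... | yes v≤b = var v , ∈-++⁺ˡ (∈-map⁺ var (∈-upTo⁺ (s≤s v≤b))) , ok , d
... | no v≰b  = let v∉ = occurs-fresh F (<⇒≤ (≰⇒> v≰b)) in
  var (nameBound F) , ∈-++⁺ˡ (∈-map⁺ var (∈-upTo⁺ ≤-refl))
  , B2ok-fresh-var c k x G e v∉ ok , ⊢-fresh-var c k x G e v∉ d
some-instance-candidate c k x G {F} e (con n , ok , d) with n ≤? nameBound F
... | yes n≤b = con n , ∈-++⁺ʳ (map var (upTo (suc (nameBound F)))) (∈-map⁺ con (∈-upTo⁺ (s≤s n≤b))) , ok , d
... | no n≰b  =
  con (nameBound F) , ∈-++⁺ʳ (map var (upTo (suc (nameBound F)))) (∈-map⁺ con (∈-upTo⁺ ≤-refl))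
  , tt , ⊢-fresh-con c k x G e (<⇒≤ (≰⇒> n≰b)) d

B2ok? : ∀ c x G t → Dec (B2ok c x G t)
B2ok? c x G (con _) = yes tt
B2ok? c x G (var v) = (ctxBinds v c ∨ freeUnder v x G) ≟ᴮ false

module Decision {F : Formula} (bf : blindFree F ≡ true)
                (decide-smaller : ∀ {H} → choices H < choices F → blindFree H ≡ true → Dec (CL2⊢ H))
                where

  premise? : ∀ c X Y → plug c X ≡ F → choices Y < choices X →
             (blindFree X ≡ true → blindFree Y ≡ true) → Dec (CL2⊢ plug c Y)
  premise? c X Y e fewer inherits =
    decide-smaller (premise-choices c X Y e fewer) (premise-blindFree c X Y e bf inherits)

  alternative? : ∀ c k G₁ G₂ Gs → plug c ⌜ alts k G₁ G₂ Gs ⌝ ≡ F →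
                 ∀ G → G ∈ G₁ ∷ G₂ ∷ Gs → Dec (CL2⊢ plug c G)
  alternative? c k G₁ G₂ Gs e G m =
    premise? c ⌜ alts k G₁ G₂ Gs ⌝ G e (choices-alternative k m) (blindFree-alternative k m)

  instance? : ∀ c k x G → plug c ⌜ quant k x G ⌝ ≡ F → ∀ t → Dec (CL2⊢ plug c (subst x t G))
  instance? c k x G e t =
    premise? c ⌜ quant k x G ⌝ (subst x t G) e (choices-instance k x G t) (blindFree-instance k x G t)

  fresh-instance? : ∀ c k x G → plug c ⌜ quant k x G ⌝ ≡ F → Dec (FreshInstance F c x G)
  fresh-instance? c k x G e =
    map′ (λ d → nameBound F , occurs-fresh F ≤-refl , d) (λ (_ , y∉ , d) → ⊢-fresh-var c k x G e y∉ d)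
         (instance? c k x G e (var (nameBound F)))

  some-instance? : ∀ c k x G → plug c ⌜ quant k x G ⌝ ≡ F → Dec (SomeInstance c x G)
  some-instance? c k x G e =
    map′ (λ (t , _ , ok , d) → t , ok , d) (some-instance-candidate c k x G e)
         (dec-∃∈ (candidates F) λ t _ → B2ok? c x G t ×-dec instance? c k x G e t)

  ruleA-at? : ∀ c X → plug c ⌜ X ⌝ ≡ F → Dec (RuleA-at F c X)
  ruleA-at? c (alts k G₁ G₂ Gs) e =
    (positive c ≟ᴮ ruleA-polarity k) →-dec dec-∀∈ _ (alternative? c k G₁ G₂ Gs e)
  ruleA-at? c (quant k x G) e =
    (positive c ≟ᴮ ruleA-polarity k) →-dec fresh-instance? c k x G e

  ruleB-at? : ∀ c X → plug c ⌜ X ⌝ ≡ F → Dec (RuleB-at c X)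
  ruleB-at? c (alts k G₁ G₂ Gs) e =
    (positive c ≟ᴮ not (ruleA-polarity k)) ×-dec dec-∃∈ _ (alternative? c k G₁ G₂ Gs e)
  ruleB-at? c (quant k x G) e =
    (positive c ≟ᴮ not (ruleA-polarity k)) ×-dec some-instance? c k x G e

  derivable? : Dec (CL2⊢ F)
  derivable? = Dec.map lastRule⇔derivable
    ((stable? F bf ×-dec dec-∀-occurrence F ruleA-at?) ⊎-dec dec-∃-occurrence F ruleB-at?)

theorem5p7 : (F : Formula) → blindFree F ≡ true → Dec (CL2⊢ F)
theorem5p7 = WF.All.wfRec (wellFounded choices <-wellFounded) _
  (λ F → blindFree F ≡ true → Dec (CL2⊢ F))
  (λ F decide-smaller bf → Decision.derivable? bf decide-smaller)
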